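{- Let $d$ be a positive integer, $n$ an odd positive integer, and $x,y$ indeterminates. Then $$\sum_{k=0}^{n-1}\frac{(x;q^d)_k\,(y;q^d)_k}{(xyq^d;q^{2d})_k}\,q^{dk}\equiv \sum_{k=0}^{n-1}\frac{(x;q^{2d})_k\,(y;q^{2d})_k}{(xyq^{d};q^{2d})_k}\,q^{2dk} \pmod{\Phi_n(q)}.$$
   Context: The $q$-shifted factorial is $(a;q)_0=1$ and $(a;q)_k=(1-a)(1-aq)\cdots(1-aq^{k-1})$ for $k\geq 1$. $\Phi_n(q)$ denotes the $n$th cyclotomic polynomial. A congruence $A\equiv B \pmod{P(q)}$ between rational functions in $q$ (with coefficients that may involve other indeterminates such as $x,y$) means that $A-B$ can be written as a quotient whose numerator is divisible by $P(q)$ and whose denominator is coprime to $P(q)$. -}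

module Defs where

open import Data.Nat as ℕ using (ℕ; zero; suc; _≟_)
import Data.Nat.Divisibility as ℕD
open import Data.Integer as ℤ using (ℤ; +_)
open import Data.List using (List; []; _∷_; _++_; map; concatMap)
open import Data.Product using (Σ; _×_; _,_; proj₁; proj₂)
open import Data.Bool using (Bool; true; false; if_then_else_; _∧_)
open import Relation.Nullary.Decidable using (⌊_⌋)
open import Relation.Binary.PropositionalEquality using (_≡_)

-- The polynomial ring ℤ[x, y, q], represented as finite formal sums of
-- monomials  c · x^a · y^b · q^e.  Two polynomials are equal (≈) when
-- all their coefficients agree.

record Mono : Set where
  constructor mono
  field
    cf : ℤ
    ex : ℕ
    ey : ℕ
    eq : ℕ

Poly : Set
Poly = List Mono

coeff : Poly → ℕ → ℕ → ℕ → ℤ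
coeff [] a b e = + 0
coeff (mono c i j k ∷ p) a b e =
  (if ⌊ i ≟ a ⌋ ∧ ⌊ j ≟ b ⌋ ∧ ⌊ k ≟ e ⌋ then c else + 0) ℤ.+ coeff p a b e

infix 4 _≈_
_≈_ : Poly → Poly → Set
p ≈ r = ∀ a b e → coeff p a b e ≡ coeff r a b e

infixl 6 _⊕_ _⊖_
infixl 7 _⊗_
infixr 8 _^^_

_⊕_ : Poly → Poly → Poly
p ⊕ r = p ++ r

⊝_ : Poly → Poly
⊝ p = map (λ { (mono c i j k) → mono (ℤ.- c) i j k }) p

_⊖_ : Poly → Poly → Poly
p ⊖ r = p ⊕ (⊝ r)

mulMono : Mono → Mono → Mono
mulMono (mono c i j k) (mono c' i' j' k') = mono (c ℤ.* c') (i ℕ.+ i') (j ℕ.+ j') (k ℕ.+ k')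

_⊗_ : Poly → Poly → Poly
p ⊗ r = concatMap (λ m → map (mulMono m) r) p

𝟘 𝟙 X Y Q : Poly
𝟘 = []
𝟙 = mono (+ 1) 0 0 0 ∷ []
X = mono (+ 1) 1 0 0 ∷ []
Y = mono (+ 1) 0 1 0 ∷ []
Q = mono (+ 1) 0 0 1 ∷ []

_^^_ : Poly → ℕ → Poly
p ^^ zero = 𝟙
p ^^ suc k = p ⊗ (p ^^ k)

infix 4 _∣_
_∣_ : Poly → Poly → Set
a ∣ b = Σ Poly λ c → b ≈ a ⊗ c

Coprime : Poly → Poly → Set
Coprime a b = ∀ g → g ∣ a → g ∣ b → g ∣ 𝟙

-- Cyclotomic polynomials, characterised by the defining recursion
--   q^m - 1 = ∏_{d ∣ m} Φ_d(q)   for all m ≥ 1,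
-- which determines Φ_m uniquely for m ≥ 1 (ℤ[x,y,q] is a domain).

prodDivUpTo : (ℕ → Poly) → ℕ → ℕ → Poly
prodDivUpTo Φ m zero = 𝟙
prodDivUpTo Φ m (suc j) =
  (if ⌊ suc j ℕD.∣? m ⌋ then Φ (suc j) else 𝟙) ⊗ prodDivUpTo Φ m j

IsCyclotomic : (ℕ → Poly) → Set
IsCyclotomic Φ = ∀ m → 1 ℕ.≤ m → (Q ^^ m) ⊖ 𝟙 ≈ prodDivUpTo Φ m m

poch : Poly → Poly → ℕ → Poly
poch a r zero = 𝟙
poch a r (suc k) = poch a r k ⊗ (𝟙 ⊖ a ⊗ (r ^^ k))

Frac : Set
Frac = Poly × Poly

num den : Frac → Poly
num = proj₁
den = proj₂

_+F_ : Frac → Frac → Frac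
(a , b) +F (c , e) = (a ⊗ e ⊕ c ⊗ b , b ⊗ e)

fsum : (ℕ → Frac) → ℕ → Frac
fsum f zero = (𝟘 , 𝟙)
fsum f (suc n) = fsum f n +F f n

-- A ≡ B (mod P): A - B = N / D with P ∣ N and D coprime to P
_≡F_[mod_] : Frac → Frac → Poly → Set
A ≡F B [mod P ] =
  Σ Poly λ N → Σ Poly λ D →
    Coprime D P × P ∣ N ×
    ((num A ⊗ den B ⊖ num B ⊗ den A) ⊗ D ≈ N ⊗ (den A ⊗ den B))

lhs : ℕ → ℕ → Frac
lhs d n = fsum (λ k →
    ( poch X (Q ^^ d) k ⊗ poch Y (Q ^^ d) k ⊗ (Q ^^ (d ℕ.* k))
    , poch (X ⊗ Y ⊗ (Q ^^ d)) (Q ^^ (2 ℕ.* d)) k )) n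

rhs : ℕ → ℕ → Frac
rhs d n = fsum (λ k →
    ( poch X (Q ^^ (2 ℕ.* d)) k ⊗ poch Y (Q ^^ (2 ℕ.* d)) k ⊗ (Q ^^ (2 ℕ.* d ℕ.* k))
    , poch (X ⊗ Y ⊗ (Q ^^ d)) (Q ^^ (2 ℕ.* d)) k )) n

{-# OPTIONS --safe #-}

-- The congruence already holds modulo qⁿ − 1.  Put p = q^d, P = p², so that pⁿ = 1, and let F(z)
-- and G(z) be the two sums with x replaced by z, both multiplied by (zyp;P)ₙ.  Creative telescoping
-- shows that F and G satisfy the same first-order recurrence
--   y(1 − z)(1 − zp) F(zP) + z(1 − zyp) F(z) = (zyp;P)ₙ₊₁ − (1 − zyp)(z;p)ₙ(y;p)ₙ,
-- because (z;p)ₙ = (z;P)ₙ for odd n.  Iterating the homogeneous recurrence of F − G around the cycle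
-- x, xP, …, xPⁿ = x gives (yⁿ + x u)(F(x) − G(x)) = 0 for some u, and yⁿ + x u is not a zero divisor
-- modulo qⁿ − 1.  The common denominator is 1 modulo x, whereas by comparison of leading monomials a
-- divisor of qⁿ − 1 does not involve x; hence they are coprime.
module Submission where

open import Algebra.Bundles using (CommutativeRing)
import Algebra.Solver.Ring as RingSolver
open import Algebra.Solver.Ring.AlmostCommutativeRing using (_-Raw-AlmostCommutative⟶_; fromCommutativeRing)
open import Data.Bool using (if_then_else_)
open import Data.Integer as ℤ using (ℤ; +_; -[1+_])
import Data.Integer.Properties as ℤ
open import Data.Integer.Tactic.RingSolver using (solve-∀)
open import Data.List using ([]; _∷_; _++_; filter; length; map)
open import Data.List.Properties using (++-assoc; length-filter)
open import Data.List.Relation.Unary.All as All using (All; []; _∷_)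
open import Data.List.Relation.Unary.All.Properties using (++⁺; map⁺)
open import Data.Maybe using (Maybe; just; nothing)
open import Data.Nat as ℕ using (ℕ; zero; suc; s≤s; z≤n)
import Data.Nat.Divisibility as ℕ
import Data.Nat.Properties as ℕ
open import Data.Product using (Σ; ∃; _×_; _,_; proj₁; proj₂)
open import Data.Product.Properties using (≡-dec)
open import Data.Product.Relation.Binary.Lex.Strict using (×-Lex; ×-compare; ×-transitive)
open import Data.Sum using (_⊎_; inj₁; inj₂; [_,_]′)
open import Function using (_∘_)
open import Level using (0ℓ)
open import Relation.Binary.Definitions using (DecidableEquality; Transitive; Trichotomous; tri<; tri≈; tri>)
open import Relation.Binary.PropositionalEquality as ≡ using (_≡_; _≢_)
open import Relation.Nullary using (¬_; ¬?; contradiction; yes; no)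
open import Relation.Nullary.Decidable using (dec-true; isYes≗does)

-- The modulus qⁿ - 1 is explicit and involves neither x nor y, so that membership in its ideal can
-- be tested on each power of x or of y separately. All regularity statements rest on this. The
-- shift z → zP is dictated by the denominators: it moves zyp by one step of their base P. At the
-- same time it moves (z;P)ₖ by one step and (z;p)ₖ by two, which is why a single recurrence can
-- serve both sums. The telescoping sequence is (z;r)ₖ(y;r)ₖ/(zyp;P)ₖ, with r = p for one sum and r
-- = P for the other. The factors of the denominators are not units of ℤ[x, y, q]/(qⁿ - 1). Hence
-- every identity is stated in cross-multiplied form, and cancellation is postponed until regularity
-- is available.

ℤ-Algebra : CommutativeRing 0ℓ 0ℓ → Set
ℤ-Algebra R = ℤ.+-*-rawRing -Raw-AlmostCommutative⟶ fromCommutativeRing R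

module IntegerSolver (R : CommutativeRing 0ℓ 0ℓ) (algebra : ℤ-Algebra R) where
  open CommutativeRing R
  open _-Raw-AlmostCommutative⟶_ algebra

  -- Agrees with ⟦_⟧ but sends 1 to 1# definitionally, so that con (+ 1) denotes 1#.
  ι : ℤ → Carrier
  ι (+ 1) = 1#
  ι z     = ⟦ z ⟧

  ι≈ : ∀ z → ι z ≈ ⟦ z ⟧
  ι≈ (+ 0)           = refl
  ι≈ (+ 1)           = sym 1-homo
  ι≈ (+ suc (suc _)) = refl
  ι≈ -[1+ _ ]        = refl

  ι-algebra : ℤ-Algebra R
  ι-algebra = record
    { ⟦_⟧    = ι
    ; +-homo = λ a b → trans (ι≈ (a ℤ.+ b)) (trans (+-homo a b) (sym (+-cong (ι≈ a) (ι≈ b))))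
    ; *-homo = λ a b → trans (ι≈ (a ℤ.* b)) (trans (*-homo a b) (sym (*-cong (ι≈ a) (ι≈ b))))
    ; -‿homo = λ a → trans (ι≈ (ℤ.- a)) (trans (-‿homo a) (sym (-‿cong (ι≈ a))))
    ; 0-homo = 0-homo
    ; 1-homo = refl
    }

  weaklyEqual? : ∀ a b → Maybe (ι a ≈ ι b)
  weaklyEqual? a b with a ℤ.≟ b
  ... | yes ≡.refl = just refl
  ... | no  _      = nothing

  open RingSolver ℤ.+-*-rawRing (fromCommutativeRing R) ι-algebra weaklyEqual? public
    using (solve; con; _:+_; _:*_; _:-_; :-_; _:=_; Polynomial)

  :1 : ∀ {n} → Polynomial n
  :1 = con (+ 1)

-- Quotient of a commutative ring by a principal ideal

module Quotient (R : CommutativeRing 0ℓ 0ℓ) (algebra : ℤ-Algebra R) (M : CommutativeRing.Carrier R) where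
  open CommutativeRing R
  open IntegerSolver R algebra
  open import Relation.Binary.Reasoning.Setoid setoid

  infix 4 _∼_
  -- The quotient is kept as data because `congruence` finally reads the cofactor of the modulus off
  -- a proof of `_∼_`.
  record _∼_ (a b : Carrier) : Set where
    constructor congruent
    field
      quotient : Carrier
      equality : a ≈ b + M * quotient

  ≈⇒∼ : ∀ {a b} → a ≈ b → a ∼ b
  ≈⇒∼ {a} {b} a≈b = congruent 0# (trans a≈b (sym (trans (+-congˡ (zeroʳ M)) (+-identityʳ b))))

  private
    ∼-sym : ∀ {a b} → a ∼ b → b ∼ a
    ∼-sym {a} {b} (congruent u h) = congruent (- u) (begin
      b                        ≈⟨ solve 3 (λ b u m → b := (b :+ m :* u) :+ m :* (:- u)) refl b u M ⟩
      (b + M * u) + M * - u    ≈⟨ +-congʳ h ⟨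
      a + M * - u              ∎)

    ∼-trans : ∀ {a b c} → a ∼ b → b ∼ c → a ∼ c
    ∼-trans {a} {b} {c} (congruent u h) (congruent v k) = congruent (v + u) (begin
      a                      ≈⟨ h ⟩
      b + M * u              ≈⟨ +-congʳ k ⟩
      (c + M * v) + M * u    ≈⟨ solve 4 (λ c u v m → (c :+ m :* v) :+ m :* u := c :+ m :* (v :+ u)) refl c u v M ⟩
      c + M * (v + u)        ∎)

    +-cong-∼ : ∀ {a b c d} → a ∼ b → c ∼ d → a + c ∼ b + d
    +-cong-∼ {b = b} {d = d} (congruent u h) (congruent v k) = congruent (u + v)
      (trans (+-cong h k) (solve 5 (λ b d u v m → (b :+ m :* u) :+ (d :+ m :* v) := b :+ d :+ m :* (u :+ v)) refl b d u v M))

    *-cong-∼ : ∀ {a b c d} → a ∼ b → c ∼ d → a * c ∼ b * d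
    *-cong-∼ {b = b} {d = d} (congruent u h) (congruent v k) = congruent (b * v + u * (d + M * v))
      (trans (*-cong h k) (solve 5 (λ b d u v m → (b :+ m :* u) :* (d :+ m :* v) := b :* d :+ m :* (b :* v :+ u :* (d :+ m :* v))) refl b d u v M))

    -‿cong-∼ : ∀ {a b} → a ∼ b → - a ∼ - b
    -‿cong-∼ {b = b} (congruent u h) = congruent (- u)
      (trans (-‿cong h) (solve 3 (λ b u m → :- (b :+ m :* u) := :- b :+ m :* (:- u)) refl b u M))

  -- Only the equality is coarsened; carrier and operations stay. Shifted factorials formed in the
  -- quotient are therefore the very polynomials formed by `poch`, and solver identities of the
  -- original ring transfer through `≈⇒∼`.
  quotientRing : CommutativeRing 0ℓ 0ℓ
  quotientRing = record
    { Carrier = Carrier ; _≈_ = _∼_ ; _+_ = _+_ ; _*_ = _*_ ; -_ = -_ ; 0# = 0# ; 1# = 1#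
    ; isCommutativeRing = record
      { isRing = record
        { +-isAbelianGroup = record
          { isGroup = record
            { isMonoid = record
              { isSemigroup = record
                { isMagma = record
                  { isEquivalence = record { refl = ≈⇒∼ refl ; sym = ∼-sym ; trans = ∼-trans }
                  ; ∙-cong = +-cong-∼ }
                ; assoc = λ a b c → ≈⇒∼ (+-assoc a b c) }
              ; identity = (λ a → ≈⇒∼ (+-identityˡ a)) , (λ a → ≈⇒∼ (+-identityʳ a)) }
            ; inverse = (λ a → ≈⇒∼ (-‿inverseˡ a)) , (λ a → ≈⇒∼ (-‿inverseʳ a))
            ; ⁻¹-cong = -‿cong-∼ }
          ; comm = λ a b → ≈⇒∼ (+-comm a b) }
        ; *-cong = *-cong-∼
        ; *-assoc = λ a b c → ≈⇒∼ (*-assoc a b c)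
        ; *-identity = (λ a → ≈⇒∼ (*-identityˡ a)) , (λ a → ≈⇒∼ (*-identityʳ a))
        ; distrib = (λ a b c → ≈⇒∼ (distribˡ a b c)) , (λ a b c → ≈⇒∼ (distribʳ a b c)) }
      ; *-comm = λ a b → ≈⇒∼ (*-comm a b) } }

  quotientAlgebra : ℤ-Algebra quotientRing
  quotientAlgebra = record
    { ⟦_⟧ = ⟦_⟧ ; +-homo = λ a b → ≈⇒∼ (+-homo a b) ; *-homo = λ a b → ≈⇒∼ (*-homo a b)
    ; -‿homo = λ a → ≈⇒∼ (-‿homo a) ; 0-homo = ≈⇒∼ 0-homo ; 1-homo = ≈⇒∼ 1-homo }
    where open _-Raw-AlmostCommutative⟶_ algebra

-- Shifted factorials and the two sums

module Pochhammer (R : CommutativeRing 0ℓ 0ℓ) (algebra : ℤ-Algebra R) where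
  open CommutativeRing R
  open IntegerSolver R algebra
  open import Relation.Binary.Reasoning.Setoid setoid

  pow : Carrier → ℕ → Carrier
  pow r zero    = 1#
  pow r (suc k) = r * pow r k

  [_⨾_]_ : Carrier → Carrier → ℕ → Carrier
  [ a ⨾ r ] zero  = 1#
  [ a ⨾ r ] suc k = [ a ⨾ r ] k * (1# - a * pow r k)

  minus-cong : ∀ {a b c d} → a ≈ b → c ≈ d → a - c ≈ b - d
  minus-cong h k = +-cong h (-‿cong k)

  pow-cong : ∀ {r s} → r ≈ s → ∀ k → pow r k ≈ pow s k
  pow-cong h zero    = refl
  pow-cong h (suc k) = *-cong h (pow-cong h k)

  pow-+ : ∀ r j k → pow r (j ℕ.+ k) ≈ pow r j * pow r k
  pow-+ r zero    k = sym (*-identityˡ _)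
  pow-+ r (suc j) k = trans (*-congˡ (pow-+ r j k)) (sym (*-assoc r _ _))

  pow-* : ∀ r j k → pow r (j ℕ.* k) ≈ pow (pow r k) j
  pow-* r zero    k = refl
  pow-* r (suc j) k = trans (pow-+ r k (j ℕ.* k)) (*-congˡ (pow-* r j k))

  pow-square : ∀ r k → pow (r * r) k ≈ pow r k * pow r k
  pow-square r zero    = sym (*-identityˡ 1#)
  pow-square r (suc k) = trans (*-congˡ (pow-square r k))
    (solve 2 (λ r s → (r :* r) :* (s :* s) := (r :* s) :* (r :* s)) refl r (pow r k))

  pow-1 : ∀ k → pow 1# k ≈ 1#
  pow-1 zero    = refl
  pow-1 (suc k) = trans (*-identityˡ _) (pow-1 k)

  poch-cong : ∀ {a b r s} → a ≈ b → r ≈ s → ∀ k → [ a ⨾ r ] k ≈ [ b ⨾ s ] k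
  poch-cong h h′ zero    = refl
  poch-cong h h′ (suc k) = *-cong (poch-cong h h′ k) (minus-cong refl (*-cong h (pow-cong h′ k)))

  -- Both sides are `[ z ⨾ r ] suc k`: on the left the first factor is split off, on the right the
  -- last.
  poch-shift : ∀ z r k → [ z * r ⨾ r ] k * (1# - z) ≈ [ z ⨾ r ] k * (1# - z * pow r k)
  poch-shift z r zero    = *-congˡ (minus-cong refl (sym (*-identityʳ z)))
  poch-shift z r (suc k) = begin
    [ z * r ⨾ r ] k * (1# - z * r * pow r k) * (1# - z)
      ≈⟨ solve 4 (λ s z r w → s :* (:1 :- z :* r :* w) :* (:1 :- z) := s :* (:1 :- z) :* (:1 :- z :* (r :* w))) refl _ z r (pow r k) ⟩
    [ z * r ⨾ r ] k * (1# - z) * (1# - z * (r * pow r k))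
      ≈⟨ *-congʳ (poch-shift z r k) ⟩
    [ z ⨾ r ] k * (1# - z * pow r k) * (1# - z * (r * pow r k)) ∎

  poch-+ : ∀ z r j k → [ z ⨾ r ] (j ℕ.+ k) ≈ [ z ⨾ r ] j * [ z * pow r j ⨾ r ] k
  poch-+ z r j zero    = trans (reflexive (≡.cong ([ z ⨾ r ]_) (ℕ.+-identityʳ j))) (sym (*-identityʳ _))
  poch-+ z r j (suc k) = begin
    [ z ⨾ r ] (j ℕ.+ suc k)
      ≈⟨ reflexive (≡.cong ([ z ⨾ r ]_) (ℕ.+-suc j k)) ⟩
    [ z ⨾ r ] (j ℕ.+ k) * (1# - z * pow r (j ℕ.+ k))
      ≈⟨ *-cong (poch-+ z r j k) (minus-cong refl (trans (*-congˡ (pow-+ r j k)) (sym (*-assoc z _ _)))) ⟩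
    [ z ⨾ r ] j * [ z * pow r j ⨾ r ] k * (1# - z * pow r j * pow r k)
      ≈⟨ *-assoc _ _ _ ⟩
    [ z ⨾ r ] j * [ z * pow r j ⨾ r ] suc k ∎

  -- The factors are sorted by the parity of the exponent of p: 0, 2, ..., 2m and 1, 3, ..., 2m - 1.
  poch-dissect : ∀ z p m → [ z ⨾ p ] suc (m ℕ.+ m) ≈ [ z ⨾ p * p ] suc m * [ z * p ⨾ p * p ] m
  poch-dissect z p zero    = sym (*-identityʳ _)
  poch-dissect z p (suc m) = begin
    [ z ⨾ p ] suc (suc m ℕ.+ suc m)
      ≈⟨ reflexive (≡.cong (λ k → [ z ⨾ p ] suc (suc k)) (ℕ.+-suc m m)) ⟩
    [ z ⨾ p ] suc (m ℕ.+ m) * (1# - z * (p * w)) * (1# - z * (p * (p * w)))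
      ≈⟨ *-cong (*-cong (poch-dissect z p m) (minus-cong refl (*-congˡ (*-congˡ w≈)))) (minus-cong refl (*-congˡ (*-congˡ (*-congˡ w≈)))) ⟩
    a * b * (1# - z * (p * v)) * (1# - z * (p * (p * v)))
      ≈⟨ solve 5 (λ a b z p v → a :* b :* (:1 :- z :* (p :* v)) :* (:1 :- z :* (p :* (p :* v)))
                   := a :* (:1 :- z :* (p :* p :* v)) :* (b :* (:1 :- z :* p :* v))) refl a b z p v ⟩
    a * (1# - z * (p * p * v)) * (b * (1# - z * p * v)) ∎
    where
    w = pow p (m ℕ.+ m)
    v = pow (p * p) m
    a = [ z ⨾ p * p ] suc m
    b = [ z * p ⨾ p * p ] m
    w≈ : w ≈ v
    w≈ = trans (pow-+ p m m) (sym (pow-square p m))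

  -- Doubling permutes the residues modulo an odd number.
  poch-square-base : ∀ z p m → pow p (suc (m ℕ.+ m)) ≈ 1# → [ z ⨾ p ] suc (m ℕ.+ m) ≈ [ z ⨾ p * p ] suc (m ℕ.+ m)
  poch-square-base z p m pⁿ≈1 = begin
    [ z ⨾ p ] suc (m ℕ.+ m)                                             ≈⟨ poch-dissect z p m ⟩
    [ z ⨾ p * p ] suc m * [ z * p ⨾ p * p ] m                           ≈⟨ *-congˡ (poch-cong (*-congˡ p≈) refl m) ⟩
    [ z ⨾ p * p ] suc m * [ z * pow (p * p) (suc m) ⨾ p * p ] m         ≈⟨ poch-+ z (p * p) (suc m) m ⟨
    [ z ⨾ p * p ] suc (m ℕ.+ m)                                         ∎
    where
    -- Since p = p · pⁿ = p²⁽ᵐ⁺¹⁾, the odd half starts exactly where the even half stops.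
    p≈ : p ≈ pow (p * p) (suc m)
    p≈ = begin
      p                                 ≈⟨ *-identityʳ p ⟨
      p * 1#                            ≈⟨ *-congˡ pⁿ≈1 ⟨
      p * (p * pow p (m ℕ.+ m))         ≈⟨ *-assoc p p _ ⟨
      p * p * pow p (m ℕ.+ m)           ≈⟨ *-congˡ (trans (pow-+ p m m) (sym (pow-square p m))) ⟩
      p * p * pow (p * p) m             ∎

  -- clearedSum t c r n is (c;r)ₙ · Σ_{k<n} t k / (c;r)ₖ.
  clearedSum : (ℕ → Carrier) → Carrier → Carrier → ℕ → Carrier
  clearedSum t c r zero    = 0#
  clearedSum t c r (suc k) = (clearedSum t c r k + t k) * (1# - c * pow r k)

  clearedSum-cong : ∀ {t t′ : ℕ → Carrier} {c c′} → (∀ k → t k ≈ t′ k) → c ≈ c′ → ∀ r k → clearedSum t c r k ≈ clearedSum t′ c′ r k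
  clearedSum-cong h h′ r zero    = refl
  clearedSum-cong h h′ r (suc k) = *-cong (+-cong (clearedSum-cong h h′ r k) (h k)) (minus-cong refl (*-congʳ h′))

  -- Divided by (c;r)ₖ₊₁, the right side of the hypothesis becomes the difference of consecutive
  -- values of A k / (c;r)ₖ. Summation and multiplication by (c;r)ₖ₊₁ = (1 - c)(cr;r)ₖ give the
  -- claim; the factor 1 - c cancels in the sum of `t′`, whose denominators thus have parameter cr.
  -- The induction performs this without dividing.
  telescope : ∀ α z c r {t t′ A : ℕ → Carrier} → A 0 ≈ 1# →
    (∀ k → α * t′ k + z * (1# - c * pow r k) * t k ≈ (1# - c * pow r k) * A k - A (suc k)) →
    ∀ k → α * clearedSum t′ (c * r) r k + z * (1# - c * pow r k) * clearedSum t c r k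
          ≈ [ c ⨾ r ] suc k - (1# - c * pow r k) * A k
  telescope α z c r {A = A} A₀≈1 step zero = begin
    α * 0# + z * (1# - c * 1#) * 0#              ≈⟨ trans (+-cong (zeroʳ _) (zeroʳ _)) (+-identityʳ 0#) ⟩
    0#                                           ≈⟨ -‿inverseʳ _ ⟨
    1# * (1# - c * 1#) - 1# * (1# - c * 1#)      ≈⟨ minus-cong refl (trans (*-comm _ _) (*-congˡ (sym A₀≈1))) ⟩
    1# * (1# - c * 1#) - (1# - c * 1#) * A 0     ∎
  telescope α z c r {t} {t′} {A} A₀≈1 step (suc k) = begin
    α * ((S′ + t′ k) * (1# - c * r * u)) + z * (1# - c * (r * u)) * ((S + t k) * (1# - c * u))
      ≈⟨ solve 9 (λ α S′ t′ c r u z S t →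
           α :* ((S′ :+ t′) :* (:1 :- c :* r :* u)) :+ z :* (:1 :- c :* (r :* u)) :* ((S :+ t) :* (:1 :- c :* u))
           := (:1 :- c :* (r :* u)) :* ((α :* S′ :+ z :* (:1 :- c :* u) :* S) :+ (α :* t′ :+ z :* (:1 :- c :* u) :* t)))
           refl α S′ (t′ k) c r u z S (t k) ⟩
    (1# - c * (r * u)) * ((α * S′ + z * (1# - c * u) * S) + (α * t′ k + z * (1# - c * u) * t k))
      ≈⟨ *-congˡ (+-cong (telescope α z c r {A = A} A₀≈1 step k) (step k)) ⟩
    (1# - c * (r * u)) * ((C - (1# - c * u) * A k) + ((1# - c * u) * A k - A (suc k)))
      ≈⟨ solve 4 (λ g C b a → g :* ((C :- b) :+ (b :- a)) := C :* g :- g :* a) refl _ C _ (A (suc k)) ⟩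
    C * (1# - c * (r * u)) - (1# - c * (r * u)) * A (suc k) ∎
    where
    u  = pow r k
    S  = clearedSum t c r k
    S′ = clearedSum t′ (c * r) r k
    C  = [ c ⨾ r ] suc k

  -- The common recurrence of the two sums and its iteration

  module Sums (p y : Carrier) where
    P : Carrier
    P = p * p

    term : Carrier → Carrier → ℕ → Carrier
    term r z k = [ z ⨾ r ] k * [ y ⨾ r ] k * pow r k

    sum : Carrier → Carrier → ℕ → Carrier
    sum r z = clearedSum (term r z) (z * y * p) P

    sum-cong : ∀ r {z z′} → z ≈ z′ → ∀ k → sum r z k ≈ sum r z′ k
    sum-cong r h = clearedSum-cong (λ k → *-congʳ (*-congʳ (poch-cong h refl k))) (*-congʳ (*-congʳ h)) P

    -- The factors 1 - z and 1 - zp are what two applications of `poch-shift` in base p consume. In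
    -- base P one application consumes 1 - z, and 1 - zp is carried along.
    α β : Carrier → Carrier
    α z = y * (1# - z) * (1# - z * p)
    β z = z * (1# - z * y * p)

    -- With K = pᵏ and the common factor (z;p)ₖ(y;p)ₖ removed, this is 1 - zypK² - (1 - zK)(1 - yK)
    -- = yK(1 - zK)(1 - zpK) + zK(1 - zypK²).
    step₁ : ∀ z k → α z * term p (z * P) k + z * (1# - z * y * p * pow P k) * term p z k
      ≈ (1# - z * y * p * pow P k) * ([ z ⨾ p ] k * [ y ⨾ p ] k) - [ z ⨾ p ] suc k * [ y ⨾ p ] suc k
    step₁ z k = begin
      α z * (a′ * b * K) + z * (1# - c * pow P k) * (a * b * K)
        ≈⟨ +-cong (solve 6 (λ y z p a′ b K → y :* (:1 :- z) :* (:1 :- z :* p) :* (a′ :* b :* K)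
                                := y :* b :* K :* (a′ :* (:1 :- z :* p) :* (:1 :- z))) refl y z p a′ b K)
                  (*-congʳ (*-congˡ U≈)) ⟩
      y * b * K * (a′ * (1# - z * p) * (1# - z)) + z * (1# - c * (K * K)) * (a * b * K)
        ≈⟨ +-congʳ (*-congˡ shifted) ⟩
      y * b * K * (a * (1# - z * K) * (1# - z * p * K)) + z * (1# - c * (K * K)) * (a * b * K)
        ≈⟨ solve 6 (λ y b K a z p →
             y :* b :* K :* (a :* (:1 :- z :* K) :* (:1 :- z :* p :* K)) :+ z :* (:1 :- z :* y :* p :* (K :* K)) :* (a :* b :* K)
             := (:1 :- z :* y :* p :* (K :* K)) :* (a :* b) :- a :* (:1 :- z :* K) :* (b :* (:1 :- y :* K))) refl y b K a z p ⟩
      (1# - c * (K * K)) * (a * b) - a * (1# - z * K) * (b * (1# - y * K))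
        ≈⟨ minus-cong (*-congʳ U≈) refl ⟨
      (1# - c * pow P k) * (a * b) - a * (1# - z * K) * (b * (1# - y * K)) ∎
      where
      c  = z * y * p
      K  = pow p k
      a  = [ z ⨾ p ] k
      a′ = [ z * P ⨾ p ] k
      b  = [ y ⨾ p ] k
      U≈ : 1# - c * pow P k ≈ 1# - c * (K * K)
      U≈ = minus-cong refl (*-congˡ (pow-square p k))
      shifted : a′ * (1# - z * p) * (1# - z) ≈ a * (1# - z * K) * (1# - z * p * K)
      shifted = begin
        a′ * (1# - z * p) * (1# - z)                          ≈⟨ *-congʳ (*-congʳ (poch-cong (sym (*-assoc z p p)) refl k)) ⟩
        [ z * p * p ⨾ p ] k * (1# - z * p) * (1# - z)         ≈⟨ *-congʳ (poch-shift (z * p) p k) ⟩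
        [ z * p ⨾ p ] k * (1# - z * p * K) * (1# - z)         ≈⟨ solve 3 (λ s g h → s :* g :* h := s :* h :* g) refl _ _ _ ⟩
        [ z * p ⨾ p ] k * (1# - z) * (1# - z * p * K)         ≈⟨ *-congʳ (poch-shift z p k) ⟩
        a * (1# - z * K) * (1# - z * p * K)                   ∎

    -- With K = Pᵏ and the common factor (z;P)ₖ(y;P)ₖ removed, this is 1 - zypK - (1 - zK)(1 - yK) =
    -- yK(1 - zp)(1 - zK) + zK(1 - zypK).
    step₂ : ∀ z k → α z * term P (z * P) k + z * (1# - z * y * p * pow P k) * term P z k
      ≈ (1# - z * y * p * pow P k) * ([ z ⨾ P ] k * [ y ⨾ P ] k) - [ z ⨾ P ] suc k * [ y ⨾ P ] suc k
    step₂ z k = begin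
      α z * (a′ * b * K) + z * (1# - c * K) * (a * b * K)
        ≈⟨ +-congʳ (solve 6 (λ y z p a′ b K → y :* (:1 :- z) :* (:1 :- z :* p) :* (a′ :* b :* K)
                                := y :* b :* K :* (:1 :- z :* p) :* (a′ :* (:1 :- z))) refl y z p a′ b K) ⟩
      y * b * K * (1# - z * p) * (a′ * (1# - z)) + z * (1# - c * K) * (a * b * K)
        ≈⟨ +-congʳ (*-congˡ (poch-shift z P k)) ⟩
      y * b * K * (1# - z * p) * (a * (1# - z * K)) + z * (1# - c * K) * (a * b * K)
        ≈⟨ solve 6 (λ y b K a z p →
             y :* b :* K :* (:1 :- z :* p) :* (a :* (:1 :- z :* K)) :+ z :* (:1 :- z :* y :* p :* K) :* (a :* b :* K)
             := (:1 :- z :* y :* p :* K) :* (a :* b) :- a :* (:1 :- z :* K) :* (b :* (:1 :- y :* K))) refl y b K a z p ⟩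
      (1# - c * K) * (a * b) - a * (1# - z * K) * (b * (1# - y * K)) ∎
      where
      c  = z * y * p
      K  = pow P k
      a  = [ z ⨾ P ] k
      a′ = [ z * P ⨾ P ] k
      b  = [ y ⨾ P ] k

    module RootOfUnity (m : ℕ) (pⁿ≈1 : pow p (suc (m ℕ.+ m)) ≈ 1#) where
      n : ℕ
      n = suc (m ℕ.+ m)

      Pⁿ≈1 : pow P n ≈ 1#
      Pⁿ≈1 = trans (pow-square p n) (trans (*-cong pⁿ≈1 pⁿ≈1) (*-identityˡ 1#))

      -- This is `telescope` at n, where Pⁿ = 1 turns the factor 1 - zypPⁿ into 1 - zyp and so
      -- produces `β`.
      recurrence : ∀ r z →
        (∀ k → α z * term r (z * P) k + z * (1# - z * y * p * pow P k) * term r z k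
          ≈ (1# - z * y * p * pow P k) * ([ z ⨾ r ] k * [ y ⨾ r ] k) - [ z ⨾ r ] suc k * [ y ⨾ r ] suc k) →
        α z * sum r (z * P) n + β z * sum r z n
          ≈ [ z * y * p ⨾ P ] suc n - (1# - z * y * p) * ([ z ⨾ r ] n * [ y ⨾ r ] n)
      recurrence r z step = begin
        α z * sum r (z * P) n + β z * sum r z n
          ≈⟨ +-cong (*-congˡ (clearedSum-cong (λ _ → refl) (solve 4 (λ z s y p → z :* s :* y :* p := z :* y :* p :* s) refl z P y p) P n))
                    (*-congʳ (*-congˡ (sym U≈))) ⟩
        α z * clearedSum (term r (z * P)) (c * P) P n + z * (1# - c * pow P n) * sum r z n
          ≈⟨ telescope (α z) z c P {A = λ k → [ z ⨾ r ] k * [ y ⨾ r ] k} (*-identityˡ 1#) step n ⟩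
        [ c ⨾ P ] suc n - (1# - c * pow P n) * ([ z ⨾ r ] n * [ y ⨾ r ] n)
          ≈⟨ minus-cong refl (*-congʳ U≈) ⟩
        [ c ⨾ P ] suc n - (1# - c) * ([ z ⨾ r ] n * [ y ⨾ r ] n) ∎
        where
        c = z * y * p
        U≈ : 1# - c * pow P n ≈ 1# - c
        U≈ = minus-cong refl (trans (*-congˡ Pⁿ≈1) (*-identityʳ c))

      difference : Carrier → Carrier
      difference z = sum p z n - sum P z n

      difference-cong : ∀ {z z′} → z ≈ z′ → difference z ≈ difference z′
      difference-cong h = minus-cong (sum-cong p h n) (sum-cong P h n)

      difference-shift : ∀ z → α z * difference (z * P) ≈ - β z * difference z
      difference-shift z = begin
        α z * (F′ - G′)
          ≈⟨ solve 6 (λ a b F F′ G G′ → a :* (F′ :- G′)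
               := (a :* F′ :+ b :* F) :- (a :* G′ :+ b :* G) :+ (:- b) :* (F :- G)) refl (α z) (β z) F F′ G G′ ⟩
        (α z * F′ + β z * F) - (α z * G′ + β z * G) + - β z * (F - G)
          ≈⟨ +-congʳ (minus-cong same refl) ⟩
        (α z * G′ + β z * G) - (α z * G′ + β z * G) + - β z * (F - G)
          ≈⟨ trans (+-congʳ (-‿inverseʳ _)) (+-identityˡ _) ⟩
        - β z * (F - G) ∎
        where
        F  = sum p z n
        F′ = sum p (z * P) n
        G  = sum P z n
        G′ = sum P (z * P) n
        same : α z * F′ + β z * F ≈ α z * G′ + β z * G
        same = trans (recurrence p z (step₁ z))
          (trans (minus-cong refl (*-congˡ (*-cong (poch-square-base z p m pⁿ≈1) (poch-square-base y p m pⁿ≈1))))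
                 (sym (recurrence P z (step₂ z))))

      module _ (x : Carrier) where
        A B : ℕ → Carrier
        A zero    = 1#
        A (suc j) = A j * α (x * pow P j)
        B zero    = 1#
        B (suc j) = B j * - β (x * pow P j)

        difference-iterate : ∀ j → A j * difference (x * pow P j) ≈ B j * difference x
        difference-iterate zero    = *-congˡ (difference-cong (*-identityʳ x))
        difference-iterate (suc j) = begin
          A j * α z * difference (x * (P * pow P j))
            ≈⟨ *-congˡ (difference-cong (solve 3 (λ x P w → x :* (P :* w) := x :* w :* P) refl x P (pow P j))) ⟩
          A j * α z * difference (z * P)             ≈⟨ *-assoc _ _ _ ⟩
          A j * (α z * difference (z * P))           ≈⟨ *-congˡ (difference-shift z) ⟩
          A j * (- β z * difference z)               ≈⟨ solve 3 (λ a b d → a :* (b :* d) := a :* d :* b) refl _ _ _ ⟩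
          A j * difference z * - β z                 ≈⟨ *-congʳ (difference-iterate j) ⟩
          B j * difference x * - β z                 ≈⟨ solve 3 (λ a b d → a :* b :* d := a :* d :* b) refl _ _ _ ⟩
          B j * - β z * difference x                 ∎
          where z = x * pow P j

        -- At x = 0 every factor of `A` reduces to y.
        A≈yʲ+x· : ∀ j → ∃ λ u → A j ≈ pow y j + x * u
        A≈yʲ+x· zero    = 0# , sym (trans (+-congˡ (zeroʳ x)) (+-identityʳ 1#))
        A≈yʲ+x· (suc j) = let u , A≈ = A≈yʲ+x· j in _ , trans (*-congʳ A≈)
          (solve 6 (λ Y x u y w p → (Y :+ x :* u) :* (y :* (:1 :- x :* w) :* (:1 :- x :* w :* p))
                    := y :* Y :+ x :* (u :* (y :* (:1 :- x :* w) :* (:1 :- x :* w :* p)) :+ Y :* (y :* (x :* w :* (w :* p) :- w :- w :* p))))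
             refl (pow y j) x u y (pow P j) p)

        -- The last factor of `B` already contains x, whence the index `suc j`.
        B≈x· : ∀ j → ∃ λ v → B (suc j) ≈ x * v
        B≈x· j = _ , solve 5 (λ b x w y p → b :* (:- (x :* w :* (:1 :- x :* w :* y :* p)))
                               := x :* (b :* (:- (w :* (:1 :- x :* w :* y :* p))))) refl (B j) x (pow P j) y p

        annihilated : ∃ λ u → (pow y n + x * u) * difference x ≈ 0#
        annihilated = u - v , (begin
          (pow y n + x * (u - v)) * D              ≈⟨ *-congʳ (solve 4 (λ Y x u v → Y :+ x :* (u :- v) := (Y :+ x :* u) :- x :* v) refl _ x u v) ⟩
          ((pow y n + x * u) - x * v) * D          ≈⟨ *-congʳ (minus-cong A≈ B≈) ⟨
          (A n - B n) * D                          ≈⟨ solve 3 (λ a b d → (a :- b) :* d := a :* d :- b :* d) refl _ _ _ ⟩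
          A n * D - B n * D                        ≈⟨ minus-cong (*-congˡ (difference-cong x≈)) (sym (difference-iterate n)) ⟩
          A n * D′ - A n * D′                      ≈⟨ -‿inverseʳ _ ⟩
          0#                                       ∎)
          where
          D  = difference x
          D′ = difference (x * pow P n)
          u  = proj₁ (A≈yʲ+x· n)
          A≈ = proj₂ (A≈yʲ+x· n)
          v  = proj₁ (B≈x· (m ℕ.+ m))
          B≈ = proj₂ (B≈x· (m ℕ.+ m))
          x≈ : x ≈ x * pow P n
          x≈ = sym (trans (*-congˡ Pⁿ≈1) (*-identityʳ x))

open import Defs
open ≡ using (refl; sym; trans; cong; cong₂; subst)

-- The ring ℤ[x, y, q]

module PolynomialRing where
  open ≡.≡-Reasoning

  Exponent : Set
  Exponent = ℕ × ℕ × ℕ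

  _≟ₑ_ : DecidableEquality Exponent
  _≟ₑ_ = ≡-dec ℕ._≟_ (≡-dec ℕ._≟_ ℕ._≟_)

  exponent : Mono → Exponent
  exponent (mono _ i j k) = i , j , k

  infixl 6 _+ₑ_
  _+ₑ_ : Exponent → Exponent → Exponent
  (i , j , k) +ₑ (i′ , j′ , k′) = i ℕ.+ i′ , j ℕ.+ j′ , k ℕ.+ k′

  +ₑ-comm : ∀ κ μ → κ +ₑ μ ≡ μ +ₑ κ
  +ₑ-comm (i , j , k) (i′ , j′ , k′) =
    cong₂ _,_ (ℕ.+-comm i i′) (cong₂ _,_ (ℕ.+-comm j j′) (ℕ.+-comm k k′))

  +ₑ-assoc : ∀ κ μ ν → (κ +ₑ μ) +ₑ ν ≡ κ +ₑ (μ +ₑ ν)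
  +ₑ-assoc (i , j , k) (i′ , j′ , k′) (i″ , j″ , k″) =
    cong₂ _,_ (ℕ.+-assoc i i′ i″) (cong₂ _,_ (ℕ.+-assoc j j′ j″) (ℕ.+-assoc k k′ k″))

  coeffₑ : Poly → Exponent → ℤ
  coeffₑ p (a , b , e) = coeff p a b e

  coeff-hit : ∀ m p {κ} → exponent m ≡ κ → coeffₑ (m ∷ p) κ ≡ Mono.cf m ℤ.+ coeffₑ p κ
  coeff-hit (mono c i j k) p refl with i ℕ.≟ i | j ℕ.≟ j | k ℕ.≟ k
  ... | yes _ | yes _ | yes _ = refl
  ... | no ≢  | _     | _     = contradiction refl ≢
  ... | yes _ | no ≢  | _     = contradiction refl ≢
  ... | yes _ | yes _ | no ≢  = contradiction refl ≢

  coeff-miss : ∀ m p {κ} → exponent m ≢ κ → coeffₑ (m ∷ p) κ ≡ coeffₑ p κ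
  coeff-miss (mono c i j k) p {a , b , e} ≢κ with i ℕ.≟ a | j ℕ.≟ b | k ℕ.≟ e
  ... | yes refl | yes refl | yes refl = contradiction refl ≢κ
  ... | no _     | _        | _        = ℤ.+-identityˡ _
  ... | yes _    | no _     | _        = ℤ.+-identityˡ _
  ... | yes _    | yes _    | no _     = ℤ.+-identityˡ _

  -- Unlike the coefficients, which they generalise, these functionals make a product an iterated pairing.
  ⟪_,_⟫ : Poly → (Exponent → ℤ) → ℤ
  ⟪ []    , φ ⟫ = + 0
  ⟪ m ∷ p , φ ⟫ = Mono.cf m ℤ.* φ (exponent m) ℤ.+ ⟪ p , φ ⟫

  δ : Exponent → Exponent → ℤ
  δ κ μ with μ ≟ₑ κ
  ... | yes _ = + 1
  ... | no  _ = + 0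

  coeff-⟪⟫ : ∀ p κ → coeffₑ p κ ≡ ⟪ p , δ κ ⟫
  coeff-⟪⟫ []      κ = refl
  coeff-⟪⟫ (m ∷ p) κ with exponent m ≟ₑ κ
  ... | yes ≡κ = trans (coeff-hit m p ≡κ) (cong₂ ℤ._+_ (sym (ℤ.*-identityʳ (Mono.cf m))) (coeff-⟪⟫ p κ))
  ... | no  ≢κ = trans (coeff-miss m p ≢κ)
                       (trans (coeff-⟪⟫ p κ)
                              (sym (trans (cong (ℤ._+ ⟪ p , δ κ ⟫) (ℤ.*-zeroʳ (Mono.cf m))) (ℤ.+-identityˡ _))))

  ⟪⟫-cong : ∀ p {φ ψ} → (∀ κ → φ κ ≡ ψ κ) → ⟪ p , φ ⟫ ≡ ⟪ p , ψ ⟫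
  ⟪⟫-cong []      φ≗ψ = refl
  ⟪⟫-cong (m ∷ p) φ≗ψ = cong₂ ℤ._+_ (cong (Mono.cf m ℤ.*_) (φ≗ψ (exponent m))) (⟪⟫-cong p φ≗ψ)

  ⟪⟫-⊕ : ∀ p r φ → ⟪ p ⊕ r , φ ⟫ ≡ ⟪ p , φ ⟫ ℤ.+ ⟪ r , φ ⟫
  ⟪⟫-⊕ []      r φ = sym (ℤ.+-identityˡ _)
  ⟪⟫-⊕ (m ∷ p) r φ = trans (cong (ℤ._+_ (Mono.cf m ℤ.* φ (exponent m))) (⟪⟫-⊕ p r φ))
    (sym (ℤ.+-assoc (Mono.cf m ℤ.* φ (exponent m)) _ _))

  ⟪⟫-⊝ : ∀ p φ → ⟪ ⊝ p , φ ⟫ ≡ ℤ.- ⟪ p , φ ⟫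
  ⟪⟫-⊝ []      φ = refl
  ⟪⟫-⊝ (mono c i j k ∷ p) φ = trans (cong (ℤ._+_ (ℤ.- c ℤ.* φ (i , j , k))) (⟪⟫-⊝ p φ)) (lemma c (φ (i , j , k)) ⟪ p , φ ⟫)
    where
    lemma : ∀ c f s → ℤ.- c ℤ.* f ℤ.+ ℤ.- s ≡ ℤ.- (c ℤ.* f ℤ.+ s)
    lemma = solve-∀

  ⟪⟫-mulMono : ∀ m r φ → ⟪ map (mulMono m) r , φ ⟫ ≡ Mono.cf m ℤ.* ⟪ r , (λ μ → φ (exponent m +ₑ μ)) ⟫
  ⟪⟫-mulMono m []       φ = sym (ℤ.*-zeroʳ (Mono.cf m))
  ⟪⟫-mulMono m (m′ ∷ r) φ = trans (cong (ℤ._+_ (Mono.cf m ℤ.* Mono.cf m′ ℤ.* φ (exponent m +ₑ exponent m′))) (⟪⟫-mulMono m r φ))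
    (lemma (Mono.cf m) (Mono.cf m′) (φ (exponent m +ₑ exponent m′)) ⟪ r , _ ⟫)
    where
    lemma : ∀ c c′ f s → c ℤ.* c′ ℤ.* f ℤ.+ c ℤ.* s ≡ c ℤ.* (c′ ℤ.* f ℤ.+ s)
    lemma = solve-∀

  ⟪⟫-⊗ : ∀ p r φ → ⟪ p ⊗ r , φ ⟫ ≡ ⟪ p , (λ κ → ⟪ r , (λ μ → φ (κ +ₑ μ)) ⟫) ⟫
  ⟪⟫-⊗ []      r φ = refl
  ⟪⟫-⊗ (m ∷ p) r φ = trans (⟪⟫-⊕ (map (mulMono m) r) (p ⊗ r) φ) (cong₂ ℤ._+_ (⟪⟫-mulMono m r φ) (⟪⟫-⊗ p r φ))

  ⟪⟫-+ : ∀ p φ ψ → ⟪ p , (λ κ → φ κ ℤ.+ ψ κ) ⟫ ≡ ⟪ p , φ ⟫ ℤ.+ ⟪ p , ψ ⟫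
  ⟪⟫-+ []      φ ψ = refl
  ⟪⟫-+ (m ∷ p) φ ψ = trans (cong (ℤ._+_ (Mono.cf m ℤ.* (φ (exponent m) ℤ.+ ψ (exponent m)))) (⟪⟫-+ p φ ψ))
    (lemma (Mono.cf m) (φ (exponent m)) (ψ (exponent m)) ⟪ p , φ ⟫ ⟪ p , ψ ⟫)
    where
    lemma : ∀ c f g s t → c ℤ.* (f ℤ.+ g) ℤ.+ (s ℤ.+ t) ≡ c ℤ.* f ℤ.+ s ℤ.+ (c ℤ.* g ℤ.+ t)
    lemma = solve-∀

  ⟪⟫-* : ∀ p c φ → ⟪ p , (λ κ → c ℤ.* φ κ) ⟫ ≡ c ℤ.* ⟪ p , φ ⟫
  ⟪⟫-* []      c φ = sym (ℤ.*-zeroʳ c)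
  ⟪⟫-* (m ∷ p) c φ = trans (cong (ℤ._+_ (Mono.cf m ℤ.* (c ℤ.* φ (exponent m)))) (⟪⟫-* p c φ))
    (lemma (Mono.cf m) c (φ (exponent m)) ⟪ p , φ ⟫)
    where
    lemma : ∀ d c f s → d ℤ.* (c ℤ.* f) ℤ.+ c ℤ.* s ≡ c ℤ.* (d ℤ.* f ℤ.+ s)
    lemma = solve-∀

  ⟪⟫-zero : ∀ p → ⟪ p , (λ _ → + 0) ⟫ ≡ + 0
  ⟪⟫-zero p = ⟪⟫-* p (+ 0) (λ _ → + 0)

  -- Interchange of two finite sums; commutativity of `⊗` comes from here.
  ⟪⟫-swap : ∀ p r (φ : Exponent → Exponent → ℤ) →
    ⟪ p , (λ κ → ⟪ r , φ κ ⟫) ⟫ ≡ ⟪ r , (λ μ → ⟪ p , (λ κ → φ κ μ) ⟫) ⟫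
  ⟪⟫-swap []      r φ = sym (⟪⟫-zero r)
  ⟪⟫-swap (m ∷ p) r φ = begin
    Mono.cf m ℤ.* ⟪ r , φ (exponent m) ⟫ ℤ.+ ⟪ p , (λ κ → ⟪ r , φ κ ⟫) ⟫
      ≡⟨ cong₂ ℤ._+_ (sym (⟪⟫-* r (Mono.cf m) (φ (exponent m)))) (⟪⟫-swap p r φ) ⟩
    ⟪ r , (λ μ → Mono.cf m ℤ.* φ (exponent m) μ) ⟫ ℤ.+ ⟪ r , (λ μ → ⟪ p , (λ κ → φ κ μ) ⟫) ⟫
      ≡⟨ sym (⟪⟫-+ r _ _) ⟩
    ⟪ r , (λ μ → ⟪ m ∷ p , (λ κ → φ κ μ) ⟫) ⟫ ∎

  coeff-⊕ : ∀ p r κ → coeffₑ (p ⊕ r) κ ≡ coeffₑ p κ ℤ.+ coeffₑ r κ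
  coeff-⊕ p r κ = trans (coeff-⟪⟫ (p ⊕ r) κ) (trans (⟪⟫-⊕ p r (δ κ)) (sym (cong₂ ℤ._+_ (coeff-⟪⟫ p κ) (coeff-⟪⟫ r κ))))

  coeff-⊝ : ∀ p κ → coeffₑ (⊝ p) κ ≡ ℤ.- coeffₑ p κ
  coeff-⊝ p κ = trans (coeff-⟪⟫ (⊝ p) κ) (trans (⟪⟫-⊝ p (δ κ)) (sym (cong ℤ.-_ (coeff-⟪⟫ p κ))))

  -- A list may contain the same exponent several times, so all its occurrences have to be collected
  -- at once before coefficients can be compared.
  remove : Exponent → Poly → Poly
  remove κ = filter (λ m → ¬? (exponent m ≟ₑ κ))

  merge-terms : ∀ c d f s → c ℤ.* f ℤ.+ (d ℤ.* f ℤ.+ s) ≡ (c ℤ.+ d) ℤ.* f ℤ.+ s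
  merge-terms = solve-∀

  ⟪⟫-remove : ∀ κ p φ → ⟪ p , φ ⟫ ≡ coeffₑ p κ ℤ.* φ κ ℤ.+ ⟪ remove κ p , φ ⟫
  ⟪⟫-remove κ []      φ = refl
  ⟪⟫-remove κ (m ∷ p) φ with exponent m ≟ₑ κ
  ... | yes refl = begin
    t ℤ.+ ⟪ p , φ ⟫                                        ≡⟨ cong (ℤ._+_ t) (⟪⟫-remove κ p φ) ⟩
    t ℤ.+ (coeffₑ p κ ℤ.* φ κ ℤ.+ s)                       ≡⟨ merge-terms (Mono.cf m) (coeffₑ p κ) (φ κ) s ⟩
    (Mono.cf m ℤ.+ coeffₑ p κ) ℤ.* φ κ ℤ.+ s               ≡⟨ cong (λ c → c ℤ.* φ κ ℤ.+ s) (coeff-hit m p refl) ⟨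
    coeffₑ (m ∷ p) κ ℤ.* φ κ ℤ.+ s                         ∎
    where
    t = Mono.cf m ℤ.* φ κ
    s = ⟪ remove κ p , φ ⟫
  ... | no ≢κ = begin
    t ℤ.+ ⟪ p , φ ⟫                                        ≡⟨ cong (ℤ._+_ t) (⟪⟫-remove κ p φ) ⟩
    t ℤ.+ (coeffₑ p κ ℤ.* φ κ ℤ.+ s)                       ≡⟨ lemma t (coeffₑ p κ ℤ.* φ κ) s ⟩
    coeffₑ p κ ℤ.* φ κ ℤ.+ (t ℤ.+ s)                       ≡⟨ cong (λ c → c ℤ.* φ κ ℤ.+ (t ℤ.+ s)) (coeff-miss m p ≢κ) ⟨
    coeffₑ (m ∷ p) κ ℤ.* φ κ ℤ.+ (t ℤ.+ s)                 ∎
    where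
    t = Mono.cf m ℤ.* φ (exponent m)
    s = ⟪ remove κ p , φ ⟫
    lemma : ∀ a b s → a ℤ.+ (b ℤ.+ s) ≡ b ℤ.+ (a ℤ.+ s)
    lemma = solve-∀

  coeff-remove-≡ : ∀ κ p → coeffₑ (remove κ p) κ ≡ + 0
  coeff-remove-≡ κ []      = refl
  coeff-remove-≡ κ (m ∷ p) with exponent m ≟ₑ κ
  ... | yes _ = coeff-remove-≡ κ p
  ... | no ≢κ = trans (coeff-miss m (remove κ p) ≢κ) (coeff-remove-≡ κ p)

  coeff-remove-≢ : ∀ κ p {μ} → κ ≢ μ → coeffₑ (remove κ p) μ ≡ coeffₑ p μ
  coeff-remove-≢ κ []      κ≢μ = refl
  coeff-remove-≢ κ (m ∷ p) {μ} κ≢μ with exponent m ≟ₑ κ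
  ... | yes refl = trans (coeff-remove-≢ κ p κ≢μ) (sym (coeff-miss m p κ≢μ))
  ... | no _ with exponent m ≟ₑ μ
  ...   | yes ≡μ = trans (coeff-hit m (remove κ p) ≡μ) (trans (cong (ℤ._+_ (Mono.cf m)) (coeff-remove-≢ κ p κ≢μ)) (sym (coeff-hit m p ≡μ)))
  ...   | no  ≢μ = trans (coeff-miss m (remove κ p) ≢μ) (trans (coeff-remove-≢ κ p κ≢μ) (sym (coeff-miss m p ≢μ)))

  -- A pairing is computed from the list, while `_≈_` sees only coefficients. The monomials sharing
  -- the exponent of the head contribute its coefficient, which is zero; removing them leaves a
  -- shorter list whose coefficients still vanish. The bound n makes this recursion structural.
  ⟪⟫-vanish : ∀ n p → length p ℕ.≤ n → (∀ κ → coeffₑ p κ ≡ + 0) → ∀ φ → ⟪ p , φ ⟫ ≡ + 0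
  ⟪⟫-vanish n       []      _         p≈0 φ = refl
  ⟪⟫-vanish (suc n) (m ∷ p) (ℕ.s≤s ≤n) p≈0 φ = begin
    c ℤ.* φ κ ℤ.+ ⟪ p , φ ⟫                                       ≡⟨ cong (ℤ._+_ (c ℤ.* φ κ)) (⟪⟫-remove κ p φ) ⟩
    c ℤ.* φ κ ℤ.+ (coeffₑ p κ ℤ.* φ κ ℤ.+ ⟪ remove κ p , φ ⟫)     ≡⟨ merge-terms c (coeffₑ p κ) (φ κ) _ ⟩
    (c ℤ.+ coeffₑ p κ) ℤ.* φ κ ℤ.+ ⟪ remove κ p , φ ⟫             ≡⟨ cong₂ (λ a b → a ℤ.* φ κ ℤ.+ b) (trans (sym (coeff-hit m p refl)) (p≈0 κ)) IH ⟩
    + 0                                                           ∎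
    where
    c = Mono.cf m
    κ = exponent m
    vanish : ∀ μ → coeffₑ (remove κ p) μ ≡ + 0
    vanish μ with κ ≟ₑ μ
    ... | yes refl = coeff-remove-≡ κ p
    ... | no κ≢μ   = trans (coeff-remove-≢ κ p κ≢μ) (trans (sym (coeff-miss m p κ≢μ)) (p≈0 μ))
    IH : ⟪ remove κ p , φ ⟫ ≡ + 0
    IH = ⟪⟫-vanish n (remove κ p) (ℕ.≤-trans (length-filter (λ m → ¬? (exponent m ≟ₑ κ)) p) ≤n) vanish φ

  infix 4 _≋_

  -- Wrapped in a record so that the two polynomials can be inferred from a proof of equality.
  record _≋_ (p r : Poly) : Set where
    constructor equal
    field equals : p ≈ r
  open _≋_ public

  ≋-via-⟪⟫ : ∀ {p r} → (∀ φ → ⟪ p , φ ⟫ ≡ ⟪ r , φ ⟫) → p ≋ r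
  ≋-via-⟪⟫ {p} {r} h = equal λ a b e → trans (coeff-⟪⟫ p (a , b , e)) (trans (h _) (sym (coeff-⟪⟫ r (a , b , e))))

  -- The difference `p ⊖ r` has only zero coefficients, so `⟪⟫-vanish` applies. Together with
  -- `≋-via-⟪⟫` this makes equality of polynomials the same as equality of all pairings, and the
  -- ring laws reduce to linearity, interchange of sums and the laws of exponents.
  ⟪⟫-≋ : ∀ {p r} → p ≋ r → ∀ φ → ⟪ p , φ ⟫ ≡ ⟪ r , φ ⟫
  ⟪⟫-≋ {p} {r} (equal p≈r) φ = ℤ.i-j≡0⇒i≡j _ _ (begin
    ⟪ p , φ ⟫ ℤ.- ⟪ r , φ ⟫     ≡⟨ cong (ℤ._+_ ⟪ p , φ ⟫) (sym (⟪⟫-⊝ r φ)) ⟩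
    ⟪ p , φ ⟫ ℤ.+ ⟪ ⊝ r , φ ⟫   ≡⟨ sym (⟪⟫-⊕ p (⊝ r) φ) ⟩
    ⟪ p ⊖ r , φ ⟫               ≡⟨ ⟪⟫-vanish _ (p ⊖ r) ℕ.≤-refl vanish φ ⟩
    + 0                         ∎)
    where
    vanish : ∀ κ → coeffₑ (p ⊖ r) κ ≡ + 0
    vanish κ@(a , b , e) = begin
      coeffₑ (p ⊖ r) κ                 ≡⟨ coeff-⊕ p (⊝ r) κ ⟩
      coeffₑ p κ ℤ.+ coeffₑ (⊝ r) κ    ≡⟨ cong₂ ℤ._+_ (p≈r a b e) (coeff-⊝ r κ) ⟩
      coeffₑ r κ ℤ.- coeffₑ r κ        ≡⟨ ℤ.+-inverseʳ (coeffₑ r κ) ⟩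
      + 0                              ∎

  ⊕-cong : ∀ {p p′ r r′} → p ≋ p′ → r ≋ r′ → p ⊕ r ≋ p′ ⊕ r′
  ⊕-cong {p} {p′} {r} {r′} h h′ = ≋-via-⟪⟫ λ φ →
    trans (⟪⟫-⊕ p r φ) (trans (cong₂ ℤ._+_ (⟪⟫-≋ h φ) (⟪⟫-≋ h′ φ)) (sym (⟪⟫-⊕ p′ r′ φ)))

  ⊕-assoc : ∀ p r s → (p ⊕ r) ⊕ s ≋ p ⊕ (r ⊕ s)
  ⊕-assoc p r s = equal λ a b e → cong (λ t → coeff t a b e) (++-assoc p r s)

  ⊗-cong : ∀ {p p′ r r′} → p ≋ p′ → r ≋ r′ → p ⊗ r ≋ p′ ⊗ r′
  ⊗-cong {p} {p′} {r} {r′} h h′ = ≋-via-⟪⟫ λ φ →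
    trans (⟪⟫-⊗ p r φ) (trans (⟪⟫-≋ h _) (trans (⟪⟫-cong p′ (λ κ → ⟪⟫-≋ h′ _)) (sym (⟪⟫-⊗ p′ r′ φ))))

  ⊗-comm : ∀ p r → p ⊗ r ≋ r ⊗ p
  ⊗-comm p r = ≋-via-⟪⟫ λ φ → begin
    ⟪ p ⊗ r , φ ⟫                                    ≡⟨ ⟪⟫-⊗ p r φ ⟩
    ⟪ p , (λ κ → ⟪ r , (λ μ → φ (κ +ₑ μ)) ⟫) ⟫       ≡⟨ ⟪⟫-swap p r _ ⟩
    ⟪ r , (λ μ → ⟪ p , (λ κ → φ (κ +ₑ μ)) ⟫) ⟫       ≡⟨ ⟪⟫-cong r (λ μ → ⟪⟫-cong p (λ κ → cong φ (+ₑ-comm κ μ))) ⟩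
    ⟪ r , (λ μ → ⟪ p , (λ κ → φ (μ +ₑ κ)) ⟫) ⟫       ≡⟨ sym (⟪⟫-⊗ r p φ) ⟩
    ⟪ r ⊗ p , φ ⟫                                    ∎

  ⊗-assoc : ∀ p r s → (p ⊗ r) ⊗ s ≋ p ⊗ (r ⊗ s)
  ⊗-assoc p r s = ≋-via-⟪⟫ λ φ → begin
    ⟪ (p ⊗ r) ⊗ s , φ ⟫
      ≡⟨ trans (⟪⟫-⊗ (p ⊗ r) s φ) (⟪⟫-⊗ p r _) ⟩
    ⟪ p , (λ κ → ⟪ r , (λ μ → ⟪ s , (λ ν → φ ((κ +ₑ μ) +ₑ ν)) ⟫) ⟫) ⟫
      ≡⟨ ⟪⟫-cong p (λ κ → ⟪⟫-cong r (λ μ → ⟪⟫-cong s (λ ν → cong φ (+ₑ-assoc κ μ ν)))) ⟩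
    ⟪ p , (λ κ → ⟪ r , (λ μ → ⟪ s , (λ ν → φ (κ +ₑ (μ +ₑ ν))) ⟫) ⟫) ⟫
      ≡⟨ sym (trans (⟪⟫-⊗ p (r ⊗ s) φ) (⟪⟫-cong p (λ κ → ⟪⟫-⊗ r s _))) ⟩
    ⟪ p ⊗ (r ⊗ s) , φ ⟫ ∎

  ⊗-identityˡ : ∀ p → 𝟙 ⊗ p ≋ p
  ⊗-identityˡ p = ≋-via-⟪⟫ λ φ → trans (⟪⟫-⊗ 𝟙 p φ) (trans (ℤ.+-identityʳ _) (ℤ.*-identityˡ _))

  ⊗-distribʳ : ∀ p r s → (r ⊕ s) ⊗ p ≋ r ⊗ p ⊕ s ⊗ p
  ⊗-distribʳ p r s = ≋-via-⟪⟫ λ φ → begin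
    ⟪ (r ⊕ s) ⊗ p , φ ⟫                  ≡⟨ trans (⟪⟫-⊗ (r ⊕ s) p φ) (⟪⟫-⊕ r s _) ⟩
    ⟪ r , _ ⟫ ℤ.+ ⟪ s , _ ⟫              ≡⟨ sym (cong₂ ℤ._+_ (⟪⟫-⊗ r p φ) (⟪⟫-⊗ s p φ)) ⟩
    ⟪ r ⊗ p , φ ⟫ ℤ.+ ⟪ s ⊗ p , φ ⟫      ≡⟨ sym (⟪⟫-⊕ (r ⊗ p) (s ⊗ p) φ) ⟩
    ⟪ r ⊗ p ⊕ s ⊗ p , φ ⟫                ∎

  ≋-sym : ∀ {p r} → p ≋ r → r ≋ p
  ≋-sym (equal h) = equal λ a b e → sym (h a b e)

  ≋-trans : ∀ {p r s} → p ≋ r → r ≋ s → p ≋ s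
  ≋-trans (equal h) (equal h′) = equal λ a b e → trans (h a b e) (h′ a b e)

  polyRing : CommutativeRing 0ℓ 0ℓ
  polyRing = record
    { Carrier = Poly ; _≈_ = _≋_ ; _+_ = _⊕_ ; _*_ = _⊗_ ; -_ = ⊝_ ; 0# = 𝟘 ; 1# = 𝟙
    ; isCommutativeRing = record
      { isRing = record
        { +-isAbelianGroup = record
          { isGroup = record
            { isMonoid = record
              { isSemigroup = record
                { isMagma = record
                  { isEquivalence = record { refl = equal λ _ _ _ → refl ; sym = ≋-sym ; trans = ≋-trans }
                  ; ∙-cong = ⊕-cong }
                ; assoc = ⊕-assoc }
              ; identity = (λ p → equal λ _ _ _ → refl) , (λ p → ≋-via-⟪⟫ λ φ → trans (⟪⟫-⊕ p 𝟘 φ) (ℤ.+-identityʳ _)) }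
            ; inverse = (λ p → ≋-via-⟪⟫ λ φ → trans (⟪⟫-⊕ (⊝ p) p φ) (trans (cong (ℤ._+ ⟪ p , φ ⟫) (⟪⟫-⊝ p φ)) (ℤ.+-inverseˡ ⟪ p , φ ⟫)))
                      , (λ p → ≋-via-⟪⟫ λ φ → trans (⟪⟫-⊕ p (⊝ p) φ) (trans (cong (ℤ._+_ ⟪ p , φ ⟫) (⟪⟫-⊝ p φ)) (ℤ.+-inverseʳ ⟪ p , φ ⟫)))
            ; ⁻¹-cong = λ {p} {r} h → ≋-via-⟪⟫ λ φ → trans (⟪⟫-⊝ p φ) (trans (cong ℤ.-_ (⟪⟫-≋ h φ)) (sym (⟪⟫-⊝ r φ))) }
          ; comm = λ p r → ≋-via-⟪⟫ λ φ → trans (⟪⟫-⊕ p r φ) (trans (ℤ.+-comm ⟪ p , φ ⟫ _) (sym (⟪⟫-⊕ r p φ))) }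
        ; *-cong = ⊗-cong
        ; *-assoc = ⊗-assoc
        ; *-identity = ⊗-identityˡ , (λ p → ≋-trans (⊗-comm p 𝟙) (⊗-identityˡ p))
        ; distrib = (λ p r s → ≋-trans (⊗-comm p (r ⊕ s)) (≋-trans (⊗-distribʳ p r s) (⊕-cong (⊗-comm r p) (⊗-comm s p)))) , ⊗-distribʳ }
      ; *-comm = ⊗-comm } }

  constant : ℤ → Poly
  constant c = mono c 0 0 0 ∷ []

open PolynomialRing

module 𝐏 = CommutativeRing polyRing

polyAlgebra : ℤ-Algebra polyRing
polyAlgebra = record
  { ⟦_⟧    = constant
  ; +-homo = λ a b → ≋-via-⟪⟫ λ φ → trans (cong (ℤ._+ + 0) (ℤ.*-distribʳ-+ (φ (0 , 0 , 0)) a b)) (ℤ.+-assoc (a ℤ.* φ (0 , 0 , 0)) _ _)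
  ; *-homo = λ a b → 𝐏.refl
  ; -‿homo = λ a → 𝐏.refl
  ; 0-homo = ≋-via-⟪⟫ λ φ → refl
  ; 1-homo = 𝐏.refl
  }

open IntegerSolver polyRing polyAlgebra using (solve; _:+_; _:*_; _:-_; :-_; _:=_; :1)

-- Regular elements modulo qⁿ − 1

data Variable : Set where
  𝐱 𝐲 : Variable

var : Variable → Poly
var 𝐱 = X
var 𝐲 = Y

degree : Variable → Mono → ℕ
degree 𝐱 = Mono.ex
degree 𝐲 = Mono.ey

raise : Variable → Exponent → Exponent
raise 𝐱 (a , b , e) = suc a , b , e
raise 𝐲 (a , b , e) = a , suc b , e

raise-injective : ∀ v {κ μ} → raise v κ ≡ raise v μ → κ ≡ μ
raise-injective 𝐱 refl = refl
raise-injective 𝐲 refl = refl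

infix 4 _FreeOf_
-- A property of the list: cancelling monomials that contain v violate it. Hence
-- `divisor-of-qⁿ-1-free` has to change the representative.
_FreeOf_ : Poly → Variable → Set
p FreeOf v = All (λ m → degree v m ≡ 0) p

-- The operator p ↦ (p - p at v = 0)/v. It is linear over polynomials free of v, so it maps
-- multiples of qⁿ - 1 to multiples of qⁿ - 1.
strip : Variable → Poly → Poly
strip v [] = []
strip 𝐱 (mono c zero    j k ∷ p) = strip 𝐱 p
strip 𝐱 (mono c (suc i) j k ∷ p) = mono c i j k ∷ strip 𝐱 p
strip 𝐲 (mono c i zero    k ∷ p) = strip 𝐲 p
strip 𝐲 (mono c i (suc j) k ∷ p) = mono c i j k ∷ strip 𝐲 p

coeff-raise : ∀ v {κ} m m′ p p′ → Mono.cf m ≡ Mono.cf m′ → exponent m′ ≡ raise v (exponent m) →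
  coeffₑ p κ ≡ coeffₑ p′ (raise v κ) → coeffₑ (m ∷ p) κ ≡ coeffₑ (m′ ∷ p′) (raise v κ)
coeff-raise v {κ} m m′ p p′ cf≡ e≡ IH with exponent m ≟ₑ κ
... | yes ≡κ = trans (coeff-hit m p ≡κ) (trans (cong₂ ℤ._+_ cf≡ IH) (sym (coeff-hit m′ p′ (trans e≡ (cong (raise v) ≡κ)))))
... | no  ≢κ = trans (coeff-miss m p ≢κ) (trans IH (sym (coeff-miss m′ p′ (≢κ ∘ raise-injective v ∘ trans (sym e≡)))))

-- Describing `strip` through coefficients shows that it does not depend on the representing list.
coeff-strip : ∀ v p κ → coeffₑ (strip v p) κ ≡ coeffₑ p (raise v κ)
coeff-strip v [] κ = refl
coeff-strip 𝐱 (m@(mono c zero    j k) ∷ p) κ = trans (coeff-strip 𝐱 p κ) (sym (coeff-miss m p λ ()))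
coeff-strip 𝐱 (m@(mono c (suc i) j k) ∷ p) κ = coeff-raise 𝐱 (mono c i j k) m (strip 𝐱 p) p refl refl (coeff-strip 𝐱 p κ)
coeff-strip 𝐲 (m@(mono c i zero    k) ∷ p) κ = trans (coeff-strip 𝐲 p κ) (sym (coeff-miss m p λ ()))
coeff-strip 𝐲 (m@(mono c i (suc j) k) ∷ p) κ = coeff-raise 𝐲 (mono c i j k) m (strip 𝐲 p) p refl refl (coeff-strip 𝐲 p κ)

strip-cong : ∀ v {p r} → p ≋ r → strip v p ≋ strip v r
strip-cong v {p} {r} (equal p≈r) = equal λ a b e →
  let κ = a , b , e ; (a′ , b′ , e′) = raise v κ in
  trans (coeff-strip v p κ) (trans (p≈r a′ b′ e′) (sym (coeff-strip v r κ)))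

strip-⊕ : ∀ v p r → strip v (p ⊕ r) ≡ strip v p ⊕ strip v r
strip-⊕ v [] r = refl
strip-⊕ 𝐱 (mono c zero    j k ∷ p) r = strip-⊕ 𝐱 p r
strip-⊕ 𝐱 (mono c (suc i) j k ∷ p) r = cong (_ ∷_) (strip-⊕ 𝐱 p r)
strip-⊕ 𝐲 (mono c i zero    k ∷ p) r = strip-⊕ 𝐲 p r
strip-⊕ 𝐲 (mono c i (suc j) k ∷ p) r = cong (_ ∷_) (strip-⊕ 𝐲 p r)

strip-mulMono : ∀ v m p → degree v m ≡ 0 → strip v (map (mulMono m) p) ≡ map (mulMono m) (strip v p)
strip-mulMono v m [] _ = refl
strip-mulMono 𝐱 m@(mono _ _ _ _) (mono c zero    j k ∷ p) refl = strip-mulMono 𝐱 m p refl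
strip-mulMono 𝐱 m@(mono _ _ _ _) (mono c (suc i) j k ∷ p) refl = cong (_ ∷_) (strip-mulMono 𝐱 m p refl)
strip-mulMono 𝐲 m@(mono _ _ _ _) (mono c i zero    k ∷ p) refl = strip-mulMono 𝐲 m p refl
strip-mulMono 𝐲 m@(mono _ _ _ _) (mono c i (suc j) k ∷ p) refl = cong (_ ∷_) (strip-mulMono 𝐲 m p refl)

strip-⊗ : ∀ v {g} p → g FreeOf v → strip v (g ⊗ p) ≡ g ⊗ strip v p
strip-⊗ v p []                 = refl
strip-⊗ v p (_∷_ {m} {g} d≡0 free) = trans (strip-⊕ v (map (mulMono m) p) (g ⊗ p))
  (cong₂ _++_ (strip-mulMono v m p d≡0) (strip-⊗ v p free))

strip-var : ∀ v p → strip v (var v ⊗ p) ≋ p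
strip-var v p = 𝐏.trans (𝐏.reflexive (lemma v p)) (𝐏.*-identityˡ p)
  where
  lemma : ∀ v p → strip v (var v ⊗ p) ≡ 𝟙 ⊗ p
  lemma 𝐱 []                 = refl
  lemma 𝐱 (mono c i j k ∷ p) = cong (_ ∷_) (lemma 𝐱 p)
  lemma 𝐲 []                 = refl
  lemma 𝐲 (mono c i j k ∷ p) = cong (_ ∷_) (lemma 𝐲 p)

strip-decreases : ∀ {N} p → All (λ m → Mono.ex m ℕ.< suc N) p → All (λ m → Mono.ex m ℕ.< N) (strip 𝐱 p)
strip-decreases []                       []             = []
strip-decreases (mono c zero    j k ∷ p) (_ ∷ h)        = strip-decreases p h
strip-decreases (mono c (suc i) j k ∷ p) (s≤s i<N ∷ h)  = i<N ∷ strip-decreases p h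

x-degree-bounded : ∀ p → ∃ λ N → All (λ m → Mono.ex m ℕ.< N) p
x-degree-bounded []      = 0 , []
x-degree-bounded (m ∷ p) = let N , h = x-degree-bounded p in
  suc (Mono.ex m) ℕ.+ N , ℕ.m≤m+n _ N ∷ All.map (λ lt → ℕ.≤-trans lt (ℕ.m≤n+m N _)) h

Y^^-free-of-𝐱 : ∀ i → Y ^^ i FreeOf 𝐱
Y^^-free-of-𝐱 zero    = refl ∷ []
Y^^-free-of-𝐱 (suc i) = ++⁺ (map⁺ (Y^^-free-of-𝐱 i)) []

Q^^n≡ : ∀ n → Q ^^ n ≡ mono (+ 1) 0 0 n ∷ []
Q^^n≡ zero    = refl
Q^^n≡ (suc n) = cong (Q ⊗_) (Q^^n≡ n)

qⁿ-1≡ : ∀ n → (Q ^^ n) ⊖ 𝟙 ≡ mono (+ 1) 0 0 n ∷ mono -[1+ 0 ] 0 0 0 ∷ []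
qⁿ-1≡ n = cong (_⊖ 𝟙) (Q^^n≡ n)

module Regular (n : ℕ) where
  M : Poly
  M = (Q ^^ n) ⊖ 𝟙

  M-free : ∀ v → M FreeOf v
  M-free v = subst (_FreeOf v) (sym (qⁿ-1≡ n)) (free v)
    where
    free : ∀ v → mono (+ 1) 0 0 n ∷ mono -[1+ 0 ] 0 0 0 ∷ [] FreeOf v
    free 𝐱 = refl ∷ refl ∷ []
    free 𝐲 = refl ∷ refl ∷ []

  open Quotient polyRing polyAlgebra M public
  private module ℛ = CommutativeRing quotientRing
  open import Relation.Binary.Reasoning.Setoid ℛ.setoid

  strip-∼𝟘 : ∀ v {p} → p ∼ 𝟘 → strip v p ∼ 𝟘
  strip-∼𝟘 v (congruent w p≋Mw) = congruent (strip v w)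
    (𝐏.trans (strip-cong v p≋Mw) (𝐏.reflexive (strip-⊗ v w (M-free v))))

  -- `strip v` undoes multiplication by v and, as M is free of v, respects the ideal of M.
  cancel-var : ∀ v {p} → var v ⊗ p ∼ 𝟘 → p ∼ 𝟘
  cancel-var v {p} h = ℛ.trans (≈⇒∼ (𝐏.sym (strip-var v p))) (strip-∼𝟘 v h)

  cancel-Y^^ : ∀ i {p} → (Y ^^ i) ⊗ p ∼ 𝟘 → p ∼ 𝟘
  cancel-Y^^ zero    {p} h = ℛ.trans (ℛ.sym (ℛ.*-identityˡ p)) h
  cancel-Y^^ (suc i) {p} h = cancel-Y^^ i (cancel-var 𝐲 (ℛ.trans (ℛ.sym (ℛ.*-assoc Y (Y ^^ i) p)) h))

  -- Modulo qⁿ − 1, the part of H of lowest degree in x is annihilated by yⁱ, hence vanishes.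
  regular : ∀ i u H → ((Y ^^ i) ⊕ X ⊗ u) ⊗ H ∼ 𝟘 → H ∼ 𝟘
  regular i u H = let N , bound = x-degree-bounded H in go N H bound
    where
    T Yⁱ : Poly
    Yⁱ = Y ^^ i
    T = Yⁱ ⊕ X ⊗ u
    -- The measure N bounds the exponents of x in H. Once H ∼ X L is known, L satisfies the same
    -- relation with a smaller bound.
    go : ∀ N H → All (λ m → Mono.ex m ℕ.< N) H → T ⊗ H ∼ 𝟘 → H ∼ 𝟘
    go zero    []      _        _    = ℛ.refl
    go zero    (_ ∷ _) (() ∷ _) _
    go (suc N) H       bound    TH∼𝟘 = begin
      H        ≈⟨ H∼XL ⟩
      X ⊗ L    ≈⟨ ℛ.*-congˡ {X} (go N L (strip-decreases H bound) (cancel-var 𝐱 XTL∼𝟘)) ⟩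
      X ⊗ 𝟘    ≈⟨ ℛ.zeroʳ X ⟩
      𝟘        ∎
      where
      L : Poly
      L = strip 𝐱 H
      strip-TH : strip 𝐱 (T ⊗ H) ≋ Yⁱ ⊗ L ⊕ u ⊗ H
      strip-TH = 𝐏.trans (strip-cong 𝐱 (solve 4 (λ Y X u H → (Y :+ X :* u) :* H := Y :* H :+ X :* (u :* H)) 𝐏.refl Yⁱ X u H))
        (𝐏.trans (𝐏.reflexive (strip-⊕ 𝐱 (Yⁱ ⊗ H) (X ⊗ (u ⊗ H))))
          (𝐏.+-cong (𝐏.reflexive (strip-⊗ 𝐱 H (Y^^-free-of-𝐱 i))) (strip-var 𝐱 (u ⊗ H))))
      YL+uH∼𝟘 : Yⁱ ⊗ L ⊕ u ⊗ H ∼ 𝟘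
      YL+uH∼𝟘 = ℛ.trans (≈⇒∼ (𝐏.sym strip-TH)) (strip-∼𝟘 𝐱 TH∼𝟘)
      -- H - X L is the part of H without x. Subtracting X times the stripped relation from T H ∼ 0
      -- removes the terms with u and leaves yⁱ times this part.
      H-XL∼𝟘 : H ⊖ X ⊗ L ∼ 𝟘
      H-XL∼𝟘 = cancel-Y^^ i (begin
        Yⁱ ⊗ (H ⊖ X ⊗ L)
          ≈⟨ ≈⇒∼ (solve 5 (λ Y X u H L → Y :* (H :- X :* L) := (Y :+ X :* u) :* H :- X :* (Y :* L :+ u :* H)) 𝐏.refl Yⁱ X u H L) ⟩
        T ⊗ H ⊖ X ⊗ (Yⁱ ⊗ L ⊕ u ⊗ H)
          ≈⟨ ℛ.+-cong TH∼𝟘 (ℛ.-‿cong (ℛ.trans (ℛ.*-congˡ {X} YL+uH∼𝟘) (ℛ.zeroʳ X))) ⟩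
        𝟘 ∎)
      H∼XL : H ∼ X ⊗ L
      H∼XL = begin
        H                        ≈⟨ ≈⇒∼ (solve 2 (λ h l → h := (h :- l) :+ l) 𝐏.refl H (X ⊗ L)) ⟩
        (H ⊖ X ⊗ L) ⊕ X ⊗ L      ≈⟨ ℛ.+-congʳ H-XL∼𝟘 ⟩
        X ⊗ L                    ∎
      XTL∼𝟘 : X ⊗ (T ⊗ L) ∼ 𝟘
      XTL∼𝟘 = begin
        X ⊗ (T ⊗ L)    ≈⟨ ≈⇒∼ (solve 3 (λ x t l → x :* (t :* l) := t :* (x :* l)) 𝐏.refl X T L) ⟩
        T ⊗ (X ⊗ L)    ≈⟨ ℛ.*-congˡ {T} H∼XL ⟨
        T ⊗ H          ≈⟨ TH∼𝟘 ⟩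
        𝟘              ∎

-- Leading monomials and coprimality

infix 4 _<ₑ_
-- Lexicographic order with x most significant: below an exponent without x lie only exponents
-- without x. Freeness of x can therefore be read off the leading exponent.
_<ₑ_ : Exponent → Exponent → Set
_<ₑ_ = ×-Lex _≡_ ℕ._<_ (×-Lex _≡_ ℕ._<_ ℕ._<_)

<ₑ-trans : Transitive _<ₑ_
<ₑ-trans {κ} {μ} {ν} = ×-transitive {_<₂_ = ×-Lex _≡_ ℕ._<_ ℕ._<_} ≡.isEquivalence (≡.resp₂ ℕ._<_) ℕ.<-trans
  (λ {κ} {μ} {ν} → ×-transitive {_<₂_ = ℕ._<_} ≡.isEquivalence (≡.resp₂ ℕ._<_) ℕ.<-trans ℕ.<-trans {κ} {μ} {ν}) {κ} {μ} {ν}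

<ₑ-compare : Trichotomous _≡_ _<ₑ_
<ₑ-compare κ μ with ×-compare sym ℕ.<-cmp (×-compare sym ℕ.<-cmp ℕ.<-cmp) κ μ
... | tri< < ≢ ≯ = tri< < (λ { refl → ≢ (refl , refl , refl) }) ≯
... | tri≈ ≮ (refl , refl , refl) ≯ = tri≈ ≮ refl ≯
... | tri> ≮ ≢ > = tri> ≮ (λ { refl → ≢ (refl , refl , refl) }) >

<ₑ-irrefl : ∀ {κ} → ¬ (κ <ₑ κ)
<ₑ-irrefl {κ} lt with <ₑ-compare κ κ
... | tri< _ ≢ _ = ≢ refl
... | tri≈ ≮ _ _ = ≮ lt
... | tri> _ ≢ _ = ≢ refl

+ₑ-monoʳ-< : ∀ κ {μ ν} → μ <ₑ ν → κ +ₑ μ <ₑ κ +ₑ ν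
+ₑ-monoʳ-< (i , j , k) (inj₁ lt)                        = inj₁ (ℕ.+-monoʳ-< i lt)
+ₑ-monoʳ-< (i , j , k) (inj₂ (refl , inj₁ lt))          = inj₂ (refl , inj₁ (ℕ.+-monoʳ-< j lt))
+ₑ-monoʳ-< (i , j , k) (inj₂ (refl , inj₂ (refl , lt))) = inj₂ (refl , inj₂ (refl , ℕ.+-monoʳ-< k lt))

+ₑ-monoˡ-< : ∀ {κ μ} ν → κ <ₑ μ → κ +ₑ ν <ₑ μ +ₑ ν
+ₑ-monoˡ-< {κ} {μ} ν lt = subst (_<ₑ μ +ₑ ν) (+ₑ-comm ν κ) (subst (ν +ₑ κ <ₑ_) (+ₑ-comm ν μ) (+ₑ-monoʳ-< ν lt))

Below : Exponent → Poly → Set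
Below κ = All (λ m → exponent m <ₑ κ)

coeff-below : ∀ {κ p} → Below κ p → coeffₑ p κ ≡ + 0
coeff-below []            = refl
coeff-below {p = m ∷ p} (lt ∷ below) = trans (coeff-miss m p (λ { refl → <ₑ-irrefl lt })) (coeff-below below)

monomial : ℤ → Exponent → Mono
monomial c (i , j , k) = mono c i j k

record Leading (p : Poly) : Set where
  field
    lc         : ℤ
    lead       : Exponent
    tail       : Poly
    lc≢0       : lc ≢ + 0
    tail-below : Below lead tail
    expansion  : p ≋ monomial lc lead ∷ tail
open Leading

∷-cong : ∀ m {p r} → p ≋ r → m ∷ p ≋ m ∷ r
∷-cong m h = 𝐏.+-congˡ {m ∷ []} h

∷-swap : ∀ m m′ p → m ∷ m′ ∷ p ≋ m′ ∷ m ∷ p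
∷-swap m m′ p = 𝐏.+-congʳ {p} {m ∷ m′ ∷ []} (𝐏.+-comm (m ∷ []) (m′ ∷ []))

∷-merge : ∀ c d κ p → monomial c κ ∷ monomial d κ ∷ p ≋ monomial (c ℤ.+ d) κ ∷ p
∷-merge c d κ p = ≋-via-⟪⟫ λ φ → trans (sym (ℤ.+-assoc (c ℤ.* φ κ) _ _)) (cong (ℤ._+ ⟪ p , φ ⟫) (sym (ℤ.*-distribʳ-+ (φ κ) c d)))

∷-drop : ∀ κ p → monomial (+ 0) κ ∷ p ≋ p
∷-drop κ p = ≋-via-⟪⟫ λ φ → ℤ.+-identityˡ _

-- Cancellation of the head against the leading term of the rest forces recursion on a shorter list.
leading : ∀ N p → length p ℕ.≤ N → p ≋ 𝟘 ⊎ Σ (Leading p) λ l → length (tail l) ℕ.< N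
leading N       []      _         = inj₁ 𝐏.refl
leading (suc N) (m@(mono c i j k) ∷ p) (s≤s ≤N) with leading N p ≤N
... | inj₁ p≋𝟘 with c ℤ.≟ + 0
...   | yes refl = inj₁ (𝐏.trans (∷-drop (i , j , k) p) p≋𝟘)
...   | no c≢0   = inj₂ (record
        { lc = c ; lead = exponent m ; tail = [] ; lc≢0 = c≢0 ; tail-below = []
        ; expansion = ∷-cong m p≋𝟘 } , s≤s z≤n)
leading (suc N) (m@(mono c i j k) ∷ p) (s≤s ≤N) | inj₂ (l , lt) with <ₑ-compare (exponent m) (lead l)
... | tri< <lead _ _ = inj₂ (record
        { lc = lc l ; lead = lead l ; tail = m ∷ tail l ; lc≢0 = lc≢0 l ; tail-below = <lead ∷ tail-below l
        ; expansion = 𝐏.trans (∷-cong m (expansion l)) (∷-swap m _ _) } , s≤s lt)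
... | tri≈ _ refl _ with c ℤ.+ lc l ℤ.≟ + 0
...   | no ≢0 = inj₂ (record
        { lc = c ℤ.+ lc l ; lead = lead l ; tail = tail l ; lc≢0 = ≢0 ; tail-below = tail-below l
        ; expansion = 𝐏.trans (∷-cong m (expansion l)) (∷-merge c (lc l) (lead l) (tail l)) } , ℕ.m<n⇒m<1+n lt)
...   | yes ≡0 = [ (λ t≋𝟘 → inj₁ (𝐏.trans p≋tail t≋𝟘))
                , (λ { (l′ , lt′) → inj₂ (record
                    { lc = lc l′ ; lead = lead l′ ; tail = tail l′ ; lc≢0 = lc≢0 l′ ; tail-below = tail-below l′
                    ; expansion = 𝐏.trans p≋tail (expansion l′) } , ℕ.m<n⇒m<1+n lt′) }) ]′
                (leading N (tail l) (ℕ.<⇒≤ lt))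
  where
  p≋tail : m ∷ p ≋ tail l
  p≋tail = 𝐏.trans (∷-cong m (expansion l)) (𝐏.trans (∷-merge c (lc l) (lead l) (tail l))
    (𝐏.trans (𝐏.reflexive (cong (λ c → monomial c (lead l) ∷ tail l) ≡0)) (∷-drop (lead l) (tail l))))
leading (suc N) (m@(mono c i j k) ∷ p) (s≤s ≤N) | inj₂ (l , lt) | tri> _ _ >lead with c ℤ.≟ + 0
... | yes refl = inj₂ (record
        { lc = lc l ; lead = lead l ; tail = tail l ; lc≢0 = lc≢0 l ; tail-below = tail-below l
        ; expansion = 𝐏.trans (∷-drop (i , j , k) p) (expansion l) } , ℕ.m<n⇒m<1+n lt)
... | no c≢0   = inj₂ (record
        { lc = c ; lead = exponent m ; tail = monomial (lc l) (lead l) ∷ tail l ; lc≢0 = c≢0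
        ; tail-below = >lead ∷ All.map (λ {m′} lt → <ₑ-trans {exponent m′} {lead l} {exponent m} lt >lead) (tail-below l)
        ; expansion = ∷-cong m (expansion l) } , s≤s lt)

All-⊗ : ∀ {P R S : Mono → Set} → (∀ {m m′} → P m → R m′ → S (mulMono m m′)) →
  ∀ {p r} → All P p → All R r → All S (p ⊗ r)
All-⊗ f []         hr = []
All-⊗ f (h ∷ hp) hr = ++⁺ (map⁺ (All.map (f h) hr)) (All-⊗ f hp hr)

-- Translation is strictly monotone, so every other product of two monomials lies strictly below the
-- sum of the leading exponents and contributes nothing to this coefficient.
coeff-lead-⊗ : ∀ {p r} (l : Leading p) (l′ : Leading r) → coeffₑ (p ⊗ r) (lead l +ₑ lead l′) ≡ lc l ℤ.* lc l′
coeff-lead-⊗ {p} {r} l l′ =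
  trans (equals (𝐏.*-cong (expansion l) (expansion l′)) _ _ _)
    (trans (coeff-hit (mulMono h h′) (map (mulMono h) (tail l′) ++ tail l ⊗ (h′ ∷ tail l′)) refl)
      (trans (cong (ℤ._+_ (lc l ℤ.* lc l′)) (coeff-below (++⁺ row rest))) (ℤ.+-identityʳ _)))
  where
  h h′ : Mono
  h  = monomial (lc l) (lead l)
  h′ = monomial (lc l′) (lead l′)
  ν : Exponent
  ν = lead l +ₑ lead l′
  row : Below ν (map (mulMono h) (tail l′))
  row = map⁺ (All.map (+ₑ-monoʳ-< (lead l)) (tail-below l′))
  rest : Below ν (tail l ⊗ (h′ ∷ tail l′))
  rest = All-⊗ {R = λ m → exponent m <ₑ lead l′ ⊎ exponent m ≡ lead l′}
    (λ { {m} {m′} lt (inj₁ lt′) → <ₑ-trans {exponent m +ₑ exponent m′} {lead l +ₑ exponent m′} {ν} (+ₑ-monoˡ-< (exponent m′) lt) (+ₑ-monoʳ-< (lead l) lt′)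
       ; {m} {m′} lt (inj₂ refl) → +ₑ-monoˡ-< (exponent m′) lt })
    (tail-below l) (inj₂ refl ∷ All.map inj₁ (tail-below l′))

-- ℤ is a domain, so the leading coefficients multiply to a nonzero coefficient of qⁿ⁺¹ - 1, whose
-- exponents do not involve x. The order then extends this from the leading monomial of g to its
-- whole expansion.
divisor-of-qⁿ-1-free : ∀ n {g h} → g ⊗ h ≋ (Q ^^ suc n) ⊖ 𝟙 → ∃ λ g′ → g ≋ g′ × g′ FreeOf 𝐱
divisor-of-qⁿ-1-free n {g} {h} gh≋M = cases (leading _ g ℕ.≤-refl) (leading _ h ℕ.≤-refl)
  where
  coeffs : ∀ κ → coeffₑ (g ⊗ h) κ ≡ coeffₑ (mono (+ 1) 0 0 (suc n) ∷ mono -[1+ 0 ] 0 0 0 ∷ []) κ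
  coeffs κ@(a , b , e) = trans (equals gh≋M a b e) (cong (λ p → coeffₑ p κ) (qⁿ-1≡ (suc n)))
  gh≢𝟘 : ¬ g ⊗ h ≋ 𝟘
  -- The positive exponent matters: in q⁰ - 1 the two monomials would cancel.
  gh≢𝟘 gh≋𝟘 with () ← trans (sym (equals gh≋𝟘 0 0 (suc n)))
    (trans (coeffs (0 , 0 , suc n)) (coeff-hit (mono (+ 1) 0 0 (suc n)) (mono -[1+ 0 ] 0 0 0 ∷ []) refl))
  -- The leading exponent of g h is that of qⁿ, so neither factor has a leading term containing x.
  lead-free : ∀ κ μ → coeffₑ (g ⊗ h) (κ +ₑ μ) ≢ + 0 → proj₁ κ ≡ 0
  lead-free (zero  , _) μ ≢0 = refl
  lead-free (suc _ , _) μ ≢0 = contradiction (coeffs _) ≢0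
  bounded : ∀ {κ m} → proj₁ κ ≡ 0 → exponent m <ₑ κ → Mono.ex m ≡ 0
  bounded refl (inj₂ (refl , _)) = refl
  cases : g ≋ 𝟘 ⊎ Σ (Leading g) _ → h ≋ 𝟘 ⊎ Σ (Leading h) _ → ∃ λ g′ → g ≋ g′ × g′ FreeOf 𝐱
  cases (inj₁ g≋𝟘) _ = contradiction (𝐏.*-congʳ {h} g≋𝟘) gh≢𝟘
  cases (inj₂ _) (inj₁ h≋𝟘) = contradiction (𝐏.trans (𝐏.*-congˡ {g} h≋𝟘) (𝐏.zeroʳ g)) gh≢𝟘
  cases (inj₂ (l , _)) (inj₂ (l′ , _)) = _ , expansion l , free ∷ All.map (λ {m} → bounded {lead l} {m} free) (tail-below l)
    where
    free : proj₁ (lead l) ≡ 0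
    free = lead-free (lead l) (lead l′) λ ≡0 →
      [ lc≢0 l , lc≢0 l′ ]′ (ℤ.i*j≡0⇒i≡0∨j≡0 (lc l) (trans (sym (coeff-lead-⊗ l l′)) ≡0))

-- The value at x = 0 is 1. This gives coprimality to divisors free of x, and also regularity modulo
-- qⁿ - 1 through `regular 0`.
OneModX : Poly → Set
OneModX p = ∃ λ u → p ≋ 𝟙 ⊕ X ⊗ u

OneModX-𝟙 : OneModX 𝟙
OneModX-𝟙 = 𝟘 , 𝐏.sym (𝐏.trans (𝐏.+-congˡ (𝐏.zeroʳ X)) (𝐏.+-identityʳ 𝟙))

OneModX-⊗ : ∀ {p r} → OneModX p → OneModX r → OneModX (p ⊗ r)
OneModX-⊗ (u , p≋) (v , r≋) = _ , 𝐏.trans (𝐏.*-cong p≋ r≋)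
  (solve 3 (λ X u v → (:1 :+ X :* u) :* (:1 :+ X :* v) := :1 :+ X :* (u :+ v :+ X :* u :* v)) 𝐏.refl X u v)

OneModX-poch : ∀ a r k → OneModX (poch (X ⊗ Y ⊗ a) r k)
OneModX-poch a r zero    = OneModX-𝟙
OneModX-poch a r (suc k) = OneModX-⊗ (OneModX-poch a r k)
  (_ , solve 4 (λ X Y a w → :1 :- X :* Y :* a :* w := :1 :+ X :* (:- (Y :* a :* w))) 𝐏.refl X Y a (r ^^ k))

OneModX-fsum : ∀ f n → (∀ k → OneModX (den (f k))) → OneModX (den (fsum f n))
OneModX-fsum f zero    h = OneModX-𝟙
OneModX-fsum f (suc n) h = OneModX-⊗ (OneModX-fsum f n h) (h n)

-- A common divisor g may be taken free of x, so setting x = 0 in g k = 1 + x v shows that g divides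
-- 1. The witness `k ⊖ X ⊗ strip 𝐱 k` is k at x = 0.
coprime-to-divisor : ∀ n {E P} → OneModX E → P ∣ (Q ^^ suc n) ⊖ 𝟙 → Coprime E P
coprime-to-divisor n {E} {P} (v , E≋) (s , M≈Ps) g (k , E≈gk) (h , P≈gh) = k ⊖ X ⊗ strip 𝐱 k , equals (𝐏.sym (begin
  g ⊗ (k ⊖ X ⊗ strip 𝐱 k)              ≈⟨ solve 4 (λ g k X l → g :* (k :- X :* l) := g :* k :- X :* (g :* l)) 𝐏.refl g k X (strip 𝐱 k) ⟩
  g ⊗ k ⊖ X ⊗ (g ⊗ strip 𝐱 k)          ≈⟨ 𝐏.+-cong gk≋ (𝐏.-‿cong (𝐏.*-congˡ {X} gL≋v)) ⟩
  (𝟙 ⊕ X ⊗ v) ⊖ X ⊗ v                  ≈⟨ solve 2 (λ o w → (o :+ w) :- w := o) 𝐏.refl 𝟙 (X ⊗ v) ⟩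
  𝟙                                    ∎))
  where
  open import Relation.Binary.Reasoning.Setoid 𝐏.setoid
  gk≋ : g ⊗ k ≋ 𝟙 ⊕ X ⊗ v
  gk≋ = 𝐏.trans (𝐏.sym (equal E≈gk)) E≋
  ghs≋M : g ⊗ (h ⊗ s) ≋ (Q ^^ suc n) ⊖ 𝟙
  ghs≋M = 𝐏.trans (𝐏.sym (𝐏.*-assoc g h s)) (𝐏.trans (𝐏.*-congʳ {s} (𝐏.sym (equal {P} {g ⊗ h} P≈gh))) (𝐏.sym (equal M≈Ps)))
  gL≋v : g ⊗ strip 𝐱 k ≋ v
  gL≋v with g′ , g≋g′ , free ← divisor-of-qⁿ-1-free n {g} {h ⊗ s} ghs≋M = begin
    g ⊗ strip 𝐱 k              ≈⟨ 𝐏.*-congʳ {strip 𝐱 k} g≋g′ ⟩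
    g′ ⊗ strip 𝐱 k             ≡⟨ strip-⊗ 𝐱 k free ⟨
    strip 𝐱 (g′ ⊗ k)           ≈⟨ strip-cong 𝐱 (𝐏.trans (𝐏.*-congʳ {k} (𝐏.sym g≋g′)) gk≋) ⟩
    strip 𝐱 (𝟙 ⊕ X ⊗ v)        ≈⟨ strip-var 𝐱 v ⟩
    v                          ∎

-- The recursion of `prodDivUpTo` starts at `suc n` itself, so Φ(n + 1) is the first factor and the
-- remaining product is the cofactor.
Φ∣qⁿ-1 : ∀ Φ → IsCyclotomic Φ → ∀ n → Φ (suc n) ∣ (Q ^^ suc n) ⊖ 𝟙
Φ∣qⁿ-1 Φ cyclotomic n = prodDivUpTo Φ (suc n) n , λ a b e →
  trans (cyclotomic (suc n) (s≤s z≤n) a b e)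
        (cong (λ c → coeff ((if c then Φ (suc n) else 𝟙) ⊗ prodDivUpTo Φ (suc n) n) a b e)
              (trans (isYes≗does (suc n ℕ.∣? suc n)) (dec-true (suc n ℕ.∣? suc n) ℕ.∣-refl)))

-- Clearing the denominators

den-fsum-cong : ∀ f g n → (∀ k → den (f k) ≡ den (g k)) → den (fsum f n) ≡ den (fsum g n)
den-fsum-cong f g zero    h = refl
den-fsum-cong f g (suc n) h = cong₂ _⊗_ (den-fsum-cong f g n h) (h n)

module OddOrder (d m : ℕ) where
  n : ℕ
  n = suc (m ℕ.+ m)

  open Regular n
  private module ℛ = CommutativeRing quotientRing
  open Pochhammer quotientRing quotientAlgebra
  open import Relation.Binary.Reasoning.Setoid ℛ.setoid

  pow≡ : ∀ r k → pow r k ≡ r ^^ k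
  pow≡ r zero    = refl
  pow≡ r (suc k) = cong (r ⊗_) (pow≡ r k)

  poch≡ : ∀ a r k → [ a ⨾ r ] k ≡ poch a r k
  poch≡ a r zero    = refl
  poch≡ a r (suc k) = cong₂ (λ s w → s ⊗ (𝟙 ⊖ a ⊗ w)) (poch≡ a r k) (pow≡ r k)

  ^^∼pow : ∀ j k → Q ^^ (j ℕ.* k) ∼ pow (Q ^^ j) k
  ^^∼pow j k = begin
    Q ^^ (j ℕ.* k)       ≡⟨ trans (sym (pow≡ Q (j ℕ.* k))) (cong (pow Q) (ℕ.*-comm j k)) ⟩
    pow Q (k ℕ.* j)      ≈⟨ pow-* Q k j ⟩
    pow (pow Q j) k      ≡⟨ cong (λ r → pow r k) (pow≡ Q j) ⟩
    pow (Q ^^ j) k       ∎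

  p : Poly
  p = Q ^^ d

  pⁿ∼𝟙 : pow p n ∼ 𝟙
  pⁿ∼𝟙 = begin
    pow p n              ≈⟨ ^^∼pow d n ⟨
    Q ^^ (d ℕ.* n)       ≡⟨ cong (Q ^^_) (ℕ.*-comm d n) ⟩
    Q ^^ (n ℕ.* d)       ≈⟨ ^^∼pow n d ⟩
    pow (Q ^^ n) d       ≈⟨ pow-cong qⁿ∼𝟙 d ⟩
    pow 𝟙 d              ≈⟨ pow-1 d ⟩
    𝟙                    ∎
    where
    qⁿ∼𝟙 : Q ^^ n ∼ 𝟙
    qⁿ∼𝟙 = congruent 𝟙 (solve 1 (λ w → w := :1 :+ (w :- :1) :* :1) 𝐏.refl (Q ^^ n))

  open Sums p Y
  open RootOfUnity m pⁿ∼𝟙 using (difference; annihilated)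

  Q^^2d∼P : Q ^^ (2 ℕ.* d) ∼ P
  Q^^2d∼P = begin
    Q ^^ (2 ℕ.* d)       ≡⟨ cong (Q ^^_) (ℕ.*-comm 2 d) ⟩
    Q ^^ (d ℕ.* 2)       ≈⟨ ^^∼pow d 2 ⟩
    p ⊗ (p ⊗ 𝟙)          ≈⟨ ℛ.*-congˡ {p} (ℛ.*-identityʳ p) ⟩
    p ⊗ p                ∎

  difference∼𝟘 : difference X ∼ 𝟘
  difference∼𝟘 = let u , h = annihilated X in
    regular n u (difference X) (subst (λ w → (w ⊕ X ⊗ u) ⊗ difference X ∼ 𝟘) (pow≡ Y n) h)

  -- `fsum` accumulates the product of all denominators, `clearedSum` only (c;r)ₖ.
  -- Cross-multiplication compares these two representations of the same sum.
  num-fsum : ∀ {c r t} f → (∀ k → num (f k) ∼ t k) → (∀ k → den (f k) ∼ [ c ⨾ r ] k) →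
    ∀ k → num (fsum f k) ⊗ [ c ⨾ r ] k ∼ clearedSum t c r k ⊗ den (fsum f k)
  num-fsum f hn hd zero = ℛ.refl
  num-fsum {c} {r} {t} f hn hd (suc k) = begin
    (N ⊗ den (f k) ⊕ num (f k) ⊗ D) ⊗ (C ⊗ g)
      ≈⟨ ℛ.*-congʳ {C ⊗ g} (ℛ.+-cong (ℛ.*-congˡ {N} (hd k)) (ℛ.*-congʳ {D} (hn k))) ⟩
    (N ⊗ C ⊕ t k ⊗ D) ⊗ (C ⊗ g)
      ≈⟨ ℛ.*-congʳ {C ⊗ g} (ℛ.+-congʳ {t k ⊗ D} (num-fsum f hn hd k)) ⟩
    (S ⊗ D ⊕ t k ⊗ D) ⊗ (C ⊗ g)
      ≈⟨ ≈⇒∼ (solve 5 (λ S D t C g → (S :* D :+ t :* D) :* (C :* g) := (S :+ t) :* g :* (D :* C)) 𝐏.refl S D (t k) C g) ⟩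
    (S ⊕ t k) ⊗ g ⊗ (D ⊗ C)
      ≈⟨ ℛ.*-congˡ {(S ⊕ t k) ⊗ g} (ℛ.*-congˡ {D} (ℛ.sym (hd k))) ⟩
    (S ⊕ t k) ⊗ g ⊗ (D ⊗ den (f k)) ∎
    where
    N D C S g : Poly
    N = num (fsum f k)
    D = den (fsum f k)
    C = [ c ⨾ r ] k
    S = clearedSum t c r k
    g = 𝟙 ⊖ c ⊗ pow r k

  c : Poly
  c = X ⊗ Y ⊗ p

  den∼ : ∀ k → poch c (Q ^^ (2 ℕ.* d)) k ∼ [ c ⨾ P ] k
  den∼ k = ℛ.trans (ℛ.reflexive (sym (poch≡ c _ k))) (poch-cong ℛ.refl Q^^2d∼P k)

  num-lhs : num (lhs d n) ⊗ [ c ⨾ P ] n ∼ sum p X n ⊗ den (lhs d n)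
  num-lhs = num-fsum _ (λ k → ℛ.*-cong (ℛ.reflexive (sym (cong₂ _⊗_ (poch≡ X p k) (poch≡ Y p k)))) (^^∼pow d k)) den∼ n

  num-rhs : num (rhs d n) ⊗ [ c ⨾ P ] n ∼ sum P X n ⊗ den (rhs d n)
  num-rhs = num-fsum _ (λ k → ℛ.*-cong
    (ℛ.trans (ℛ.reflexive (sym (cong₂ _⊗_ (poch≡ X _ k) (poch≡ Y _ k)))) (ℛ.*-cong (poch-cong ℛ.refl Q^^2d∼P k) (poch-cong ℛ.refl Q^^2d∼P k)))
    (ℛ.trans (^^∼pow (2 ℕ.* d) k) (pow-cong Q^^2d∼P k))) den∼ n

  den≡ : den (lhs d n) ≡ den (rhs d n)
  den≡ = den-fsum-cong _ _ n λ _ → refl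

  -- The equal denominators turn `difference∼𝟘` into a relation for the numerators multiplied by
  -- (c;P)ₙ. This factor is congruent to some 1 + x u and is cancelled by `regular` with i = 0.
  num∼ : num (lhs d n) ⊖ num (rhs d n) ∼ 𝟘
  num∼ = let u , poch≋ = OneModX-poch p (Q ^^ (2 ℕ.* d)) n in regular 0 u (A ⊖ B) (begin
    (𝟙 ⊕ X ⊗ u) ⊗ (A ⊖ B)                 ≈⟨ ℛ.*-congʳ {A ⊖ B} (≈⇒∼ poch≋) ⟨
    poch c (Q ^^ (2 ℕ.* d)) n ⊗ (A ⊖ B)   ≈⟨ ℛ.*-congʳ {A ⊖ B} (den∼ n) ⟩
    C ⊗ (A ⊖ B)                           ≈⟨ ≈⇒∼ (solve 3 (λ C A B → C :* (A :- B) := A :* C :- B :* C) 𝐏.refl C A B) ⟩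
    A ⊗ C ⊖ B ⊗ C                         ≈⟨ minus-cong num-lhs (ℛ.trans num-rhs (ℛ.*-congˡ {G} (ℛ.reflexive (sym den≡)))) ⟩
    F ⊗ E ⊖ G ⊗ E                         ≈⟨ ≈⇒∼ (solve 3 (λ F G E → F :* E :- G :* E := (F :- G) :* E) 𝐏.refl F G E) ⟩
    (F ⊖ G) ⊗ E                           ≈⟨ ℛ.*-congʳ {E} difference∼𝟘 ⟩
    𝟘                                     ∎)
    where
    A B C E F G : Poly
    A = num (lhs d n)
    B = num (rhs d n)
    C = [ c ⨾ P ] n
    E = den (lhs d n)
    F = sum p X n
    G = sum P X n

  -- With the common denominator E the difference of the fractions is (A - B)/E, which supplies N
  -- and D.
  congruence : ∀ Ψ → Ψ ∣ M → lhs d n ≡F rhs d n [mod Ψ ]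
  congruence Ψ (s , M≈Ψs) =
      A ⊖ B , E
    , coprime-to-divisor (m ℕ.+ m) {P = Ψ} (OneModX-fsum _ n (OneModX-poch p (Q ^^ (2 ℕ.* d)))) (s , M≈Ψs)
    , (let congruent w A-B≋Mw = num∼ in s ⊗ w ,
        equals (𝐏.trans A-B≋Mw (𝐏.trans (𝐏.*-congʳ {w} (equal {M} {Ψ ⊗ s} M≈Ψs)) (𝐏.*-assoc Ψ s w))))
    , subst (λ E′ → (A ⊗ E′ ⊖ B ⊗ E) ⊗ E ≈ (A ⊖ B) ⊗ (E ⊗ E′)) den≡
        (equals (solve 3 (λ A B E → (A :* E :- B :* E) :* E := (A :- B) :* (E :* E)) 𝐏.refl A B E))
    where
    A B E : Poly
    A = num (lhs d n)
    B = num (rhs d n)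
    E = den (lhs d n)

open import Data.Nat using (_≤_; _+_; _*_)

theorem1p4 : (Φ : ℕ → Poly) → IsCyclotomic Φ →
    (d n : ℕ) → 1 ≤ d → ∃ (λ m → n ≡ 1 + 2 * m) →
    lhs d n ≡F rhs d n [mod Φ n ]
theorem1p4 Φ cyclotomic d n _ (m , n≡) with refl ← trans n≡ (cong (λ k → suc (m + k)) (ℕ.+-identityʳ m)) =
  OddOrder.congruence d m (Φ (suc (m + m))) (Φ∣qⁿ-1 Φ cyclotomic (m + m))
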